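{- For every integer $n\geq 1$, $\mathrm{ex}_{\mathcal{P}}(n,S_{3,4})\leq \frac{20}{7}n$.
   Context: All graphs are finite and simple. For a graph $F$, the planar Turán number $\mathrm{ex}_{\mathcal{P}}(n,F)$ is the maximum number of edges in an $n$-vertex planar graph that contains no subgraph isomorphic to $F$. For positive integers $m,k$, the double star $S_{m,k}$ is the tree obtained from an edge $xy$ (the backbone) by joining $x$ to $m$ new vertices and $y$ to $k$ further new vertices, all these $m+k$ vertices distinct. -}

module Defs where

open import Data.Bool using (Bool; true; false; T)
open import Data.Bool.Properties using (T?)
open import Data.Fin using (Fin; _<?_)
open import Data.Fin.Properties using (all?)
open import Data.List using (length; filter; allFin; cartesianProduct)
open import Data.Nat using (ℕ; _+_; _*_; _≤_)
open import Data.Product using (Σ-syntax; ∃-syntax; _×_; _,_)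
open import Function.Bundles using (_↔_; Inverse; Bijection)
open import Function.Definitions using (Injective)
open import Level using (0ℓ)
open import Relation.Binary.Bundles using (Setoid)
open import Relation.Binary.Core using (Rel)
import Relation.Binary.Construct.Closure.Equivalence as EqClosure
open import Relation.Binary.PropositionalEquality using (_≡_; refl; subst)
import Relation.Binary.PropositionalEquality as ≡
open import Relation.Nullary using (¬_; ¬?; _×-dec_)

record Graph (V : Set) : Set where
  field
    adj         : V → V → Bool
    symmetric   : ∀ u v → adj u v ≡ adj v u
    irreflexive : ∀ v → adj v v ≡ false

  Adj : Rel V 0ℓ
  Adj u v = T (adj u v)

-- Not necessarily induced: G has a subgraph isomorphic to H.
Contains : ∀ {V W} → Graph V → Graph W → Set
Contains {V} {W} G H =
  Σ[ f ∈ (W → V) ] Injective _≡_ _≡_ f × (∀ u v → Graph.Adj H u v → Graph.Adj G (f u) (f v))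

edgeCount : ∀ {n} → Graph (Fin n) → ℕ
edgeCount {n} G =
  length (filter (λ (u , v) → (u <? v) ×-dec T? (adj u v)) (cartesianProduct (allFin n) (allFin n)))
  where open Graph G

isolatedCount : ∀ {n} → Graph (Fin n) → ℕ
isolatedCount {n} G = length (filter (λ v → all? (λ w → ¬? (T? (adj v w)))) (allFin n))
  where open Graph G

data DoubleStarVertex (m k : ℕ) : Set where
  xCentre yCentre : DoubleStarVertex m k
  xLeaf           : Fin m → DoubleStarVertex m k
  yLeaf           : Fin k → DoubleStarVertex m k

doubleStar : ∀ m k → Graph (DoubleStarVertex m k)
doubleStar m k = record { adj = a ; symmetric = a-sym ; irreflexive = a-irrefl }
  where
  a : DoubleStarVertex m k → DoubleStarVertex m k → Bool
  a xCentre   yCentre   = true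
  a yCentre   xCentre   = true
  a xCentre   (xLeaf _) = true
  a (xLeaf _) xCentre   = true
  a yCentre   (yLeaf _) = true
  a (yLeaf _) yCentre   = true
  a xCentre   xCentre   = false
  a xCentre   (yLeaf _) = false
  a yCentre   yCentre   = false
  a yCentre   (xLeaf _) = false
  a (xLeaf _) yCentre   = false
  a (xLeaf _) (xLeaf _) = false
  a (xLeaf _) (yLeaf _) = false
  a (yLeaf _) xCentre   = false
  a (yLeaf _) (xLeaf _) = false
  a (yLeaf _) (yLeaf _) = false

  a-sym : ∀ u v → a u v ≡ a v u
  a-sym xCentre   xCentre   = refl
  a-sym xCentre   yCentre   = refl
  a-sym xCentre   (xLeaf _) = refl
  a-sym xCentre   (yLeaf _) = refl
  a-sym yCentre   xCentre   = refl
  a-sym yCentre   yCentre   = refl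
  a-sym yCentre   (xLeaf _) = refl
  a-sym yCentre   (yLeaf _) = refl
  a-sym (xLeaf _) xCentre   = refl
  a-sym (xLeaf _) yCentre   = refl
  a-sym (xLeaf _) (xLeaf _) = refl
  a-sym (xLeaf _) (yLeaf _) = refl
  a-sym (yLeaf _) xCentre   = refl
  a-sym (yLeaf _) yCentre   = refl
  a-sym (yLeaf _) (xLeaf _) = refl
  a-sym (yLeaf _) (yLeaf _) = refl

  a-irrefl : ∀ v → a v v ≡ false
  a-irrefl xCentre   = refl
  a-irrefl yCentre   = refl
  a-irrefl (xLeaf _) = refl
  a-irrefl (yLeaf _) = refl

record Dart {V : Set} (G : Graph V) : Set where
  constructor dart
  field
    source target : V
    adjacent      : Graph.Adj G source target

open Dart public

opposite : ∀ {V} {G : Graph V} → Dart G → Dart G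
opposite {G = G} (dart u v uv) = dart v u (subst T (Graph.symmetric G u v) uv)

-- For a permutation f of a finite set the classes are the cycles of f.
orbits : ∀ {A : Set} → (A → A) → Setoid 0ℓ 0ℓ
orbits f = EqClosure.setoid (λ a b → f a ≡ b)

components : ∀ {V} → Graph V → Setoid 0ℓ 0ℓ
components G = EqClosure.setoid (Graph.Adj G)

HasClasses : Setoid 0ℓ 0ℓ → ℕ → Set
HasClasses S k = Bijection S (≡.setoid (Fin k))

-- `cyclic` makes the neighbours of each vertex a single cycle of the rotation.
record RotationSystem {V : Set} (G : Graph V) : Set where
  field
    rotation : Dart G ↔ Dart G
    source-≡ : ∀ d → source (Inverse.to rotation d) ≡ source d
    cyclic   : ∀ d e → source d ≡ source e →
               Setoid._≈_ (orbits (Inverse.to rotation)) d e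

  -- After traversing a dart, leave its target along the next dart in the
  -- rotation; the orbits are the facial walks.
  nextInFace : Dart G → Dart G
  nextInFace d = Inverse.to rotation (opposite d)

-- Planarity, combinatorially: every rotation system embeds each connected
-- component cellularly in a closed orientable surface, with
-- V - E + F = 2 - 2·genus, and the graph is planar iff some rotation system has
-- genus 0 on every component. Since 2 - 2·genus ≤ 2, this is equivalent to the
-- sum of V - E + F over the components being twice their number.
-- An isolated vertex lies on no dart, yet its embedding in the sphere has one
-- face; `isolatedCount` supplies these faces.
record Planar {n : ℕ} (G : Graph (Fin n)) : Set where
  field
    rotationSystem : RotationSystem G
    f c            : ℕ
    facialWalks    : HasClasses (orbits (RotationSystem.nextInFace rotationSystem)) f
    componentCount : HasClasses (components G) c
    euler          : n + (f + isolatedCount G) ≡ edgeCount G + 2 * c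

-- m = ex_𝒫(n, F), as a relation: m is attained, and it is an upper bound.
IsPlanarTuránNumber : ∀ {W} → ℕ → Graph W → ℕ → Set
IsPlanarTuránNumber n F m =
  (∃[ G ] Planar {n} G × ¬ Contains G F × edgeCount G ≡ m) ×
  (∀ (G : Graph (Fin n)) → Planar G → ¬ Contains G F → edgeCount G ≤ m)

{-# OPTIONS --safe #-}

-- Two adjacent vertices of degrees at least 4 and 5 in an S₃,₄-free graph have many common neighbours
-- (Hall's theorem for the leaves): d(u) + d(v) ≤ 8 + c(u,v). Hence a vertex of degree at least 8 has
-- only neighbours of degree at most 3, and around a vertex of degree 6 or 7 the neighbourhood is so
-- dense that planarity forces neighbours of small degree. Discharging with 40/7 as the target average
-- degree then works vertex by vertex, except at degree-3 vertices all of whose neighbours have degree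
-- at least 8; these span a bipartite graph with the vertices of degree at least 8, so that planarity
-- bounds their number by twice the number of such vertices, which have charge to spare.
--
-- Both uses of planarity are Euler's bound for the subgraph induced by a vertex set S. Rather than
-- deleting edges from the embedding, we merge the faces of G on the two sides of every edge that is
-- not inside S. Each merge costs at most one region, and the edges of a spanning forest that joins
-- the other vertices to S cost nothing, because turning around a vertex crosses all its other edges.

module Submission where

open import Defs
open import Data.Bool using (true; false; T)
open import Data.Bool.Properties using (T?; T-irrelevant)
open import Data.Fin using (Fin; zero; suc; toℕ; combine; punchIn; punchOut; _↑ˡ_; _↑ʳ_; _<?_)
import Data.Fin as Fin
import Data.Fin.Properties as Fin
import Data.Integer as ℤ
import Data.Integer.Properties as ℤ
open import Data.List
  using (List; []; _∷_; _++_; length; map; filter; take; drop; lookup; tabulate; allFin; cartesianProduct)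
open import Data.List.Membership.Propositional using (_∈_)
open import Data.List.Membership.Propositional.Properties
  using (∈-filter⁺; ∈-cartesianProduct⁺; ∈-allFin; ∈-lookup)
open import Data.List.Properties using (length-++; filter-++; map-tabulate; length-map; length-take)
open import Data.List.Relation.Unary.All as All using (All; []; _∷_)
import Data.List.Relation.Unary.All.Properties as All
open import Data.List.Relation.Unary.AllPairs using ([]; _∷_)
open import Data.List.Relation.Unary.Any using (here; there)
open import Data.List.Relation.Unary.Unique.Propositional using (Unique)
import Data.List.Relation.Unary.Unique.Propositional.Properties as Unique
open import Data.Nat using (ℕ; zero; suc; _+_; _*_; _⊓_; _≤_; _<_; _≥_; z≤n; s≤s; _≤?_)
open import Data.Nat.GeneralisedArithmetic using (iterate)
open import Data.Nat.Properties hiding (_<?_)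
open import Data.Nat.Tactic.RingSolver using (solve-∀)
open import Algebra.Properties.Semiring.Sum +-*-semiring
  using (sum; sum-syntax; sum-cong-≗; sum-replicate-zero; ∑-distrib-+; ∑-comm; *-distribˡ-sum; *-distribʳ-sum)
open import Data.Product using (∃-syntax; Σ-syntax; _×_; _,_; proj₁; proj₂; uncurry)
import Data.Product.Properties as Product
open import Data.Rational.Unnormalised using (_/_; *≤*)
import Data.Rational.Unnormalised as ℚᵘ
open import Data.Sum using (_⊎_; inj₁; inj₂; [_,_]′)
open import Function using (_∘_; id)
open import Function.Bundles using (Inverse; Bijection)
open import Function.Definitions using (Injective; StrictlySurjective)
open import Relation.Binary.Construct.Closure.Equivalence using (EqClosure)
import Relation.Binary.Construct.Closure.Equivalence as EqClosure
open import Relation.Binary.Construct.Closure.ReflexiveTransitive using (ε; _◅_)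
open import Relation.Binary.Construct.Closure.Symmetric using (fwd; bwd)
open import Relation.Binary.Definitions using (tri<; tri≈; tri>)
open import Relation.Binary.PropositionalEquality hiding ([_])
open import Relation.Nullary
  using (Dec; yes; no; _because_; ¬_; ¬?; _×-dec_; _⊎-dec_; _→-dec_; contradiction)
open import Relation.Unary using (Pred; Decidable)

-- Counting by sums of indicators

-- Only the boolean is inspected, so the indicator of a compound decision reduces as soon as its
-- truth value does.
[_] : ∀ {p} {P : Set p} → Dec P → ℕ
[ true because _ ] = 1
[ false because _ ] = 0

[]≤1 : ∀ {p} {P : Set p} (P? : Dec P) → [ P? ] ≤ 1
[]≤1 (yes _) = ≤-refl
[]≤1 (no _)  = z≤n

[]-yes : ∀ {p} {P : Set p} (P? : Dec P) → P → [ P? ] ≡ 1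
[]-yes (yes _) _ = refl
[]-yes (no ¬p) p = contradiction p ¬p

[]-no : ∀ {p} {P : Set p} (P? : Dec P) → ¬ P → [ P? ] ≡ 0
[]-no (yes p) ¬p = contradiction p ¬p
[]-no (no _)  _  = refl

[]-mono : ∀ {p q} {P : Set p} {Q : Set q} (P? : Dec P) (Q? : Dec Q) → (P → Q) → [ P? ] ≤ [ Q? ]
[]-mono (no _)  _  _   = z≤n
[]-mono (yes p) Q? P⇒Q = ≤-reflexive (sym ([]-yes Q? (P⇒Q p)))

[]-cong : ∀ {p q} {P : Set p} {Q : Set q} (P? : Dec P) (Q? : Dec Q) → (P → Q) → (Q → P) → [ P? ] ≡ [ Q? ]
[]-cong (no ¬p) Q? _   Q⇒P = sym ([]-no Q? (¬p ∘ Q⇒P))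
[]-cong (yes p) Q? P⇒Q _   = sym ([]-yes Q? (P⇒Q p))

[]-disjoint : ∀ {p q r} {P : Set p} {Q : Set q} {R : Set r} (P? : Dec P) (Q? : Dec Q) (R? : Dec R) →
              (P → R) → (Q → R) → (P → ¬ Q) → [ P? ] + [ Q? ] ≤ [ R? ]
[]-disjoint (yes p) (yes q) _  _   _   P⇒¬Q = contradiction q (P⇒¬Q p)
[]-disjoint (yes p) (no _)  R? P⇒R _   _    = ≤-reflexive (sym ([]-yes R? (P⇒R p)))
[]-disjoint (no _)  Q?      R? _   Q⇒R _    = []-mono Q? R? Q⇒R

sum-mono : ∀ {n} {f g : Fin n → ℕ} → (∀ i → f i ≤ g i) → sum f ≤ sum g
sum-mono {zero}  f≤g = z≤n
sum-mono {suc n} f≤g = +-mono-≤ (f≤g zero) (sum-mono (f≤g ∘ suc))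

sum-const : ∀ n x → ∑[ i < n ] x ≡ n * x
sum-const zero    x = refl
sum-const (suc n) x = cong (x +_) (sum-const n x)

term≤sum : ∀ {n} (f : Fin n → ℕ) i → f i ≤ sum f
term≤sum f zero    = m≤m+n _ _
term≤sum f (suc i) = ≤-trans (term≤sum (f ∘ suc) i) (m≤n+m _ _)

sum-zero : ∀ {n} (f : Fin n → ℕ) → (∀ i → f i ≡ 0) → sum f ≡ 0
sum-zero {n} f f≡0 = trans (sum-cong-≗ f≡0) (sum-replicate-zero n)

count-unique : ∀ {n p} {P : Pred (Fin n) p} (P? : Decidable P) →
               (∀ {i j} → P i → P j → i ≡ j) → ∑[ i < n ] [ P? i ] ≤ 1
count-unique {zero}  P? unique = z≤n
count-unique {suc n} P? unique with P? zero
... | yes p = ≤-reflexive (cong suc (sum-zero _ λ i →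
                []-no (P? (suc i)) λ q → contradiction (unique p q) λ ()))
... | no _  = count-unique (P? ∘ suc) λ p q → Fin.suc-injective (unique p q)

count-fibre : ∀ {n p} {P : Set p} (P? : Dec P) (x : Fin n) → ∑[ i < n ] [ P? ×-dec x Fin.≟ i ] ≡ [ P? ]
count-fibre {n} (no _) x = sum-replicate-zero n
count-fibre P?@(yes p) x = ≤-antisym
  (count-unique (λ i → P? ×-dec x Fin.≟ i) λ (_ , x≡i) (_ , x≡j) → trans (sym x≡i) x≡j)
  (≤-trans (≤-reflexive (sym ([]-yes (P? ×-dec x Fin.≟ x) (p , refl))))
           (term≤sum (λ i → [ P? ×-dec x Fin.≟ i ]) x))

count-× : ∀ {n p q} {P : Set p} {Q : Pred (Fin n) q} (P? : Dec P) (Q? : Decidable Q) →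
          [ P? ] * ∑[ i < n ] [ Q? i ] ≡ ∑[ i < n ] [ P? ×-dec Q? i ]
count-× {n} (no _)  Q? = sym (sum-replicate-zero n)
count-× {n} P?@(yes p) Q? = trans (+-identityʳ (∑[ i < n ] [ Q? i ]))
  (sum-cong-≗ λ i → []-cong (Q? i) (P? ×-dec Q? i) (p ,_) proj₂)

-- Double counting of the pairs `(i , g i)`: every `i` in `P` lies in one, and injectivity allows at
-- most one above each `j`, none unless `Q j`.
count-injective : ∀ {m n p q} {P : Pred (Fin m) p} {Q : Pred (Fin n) q}
                  (P? : Decidable P) (Q? : Decidable Q) (g : Fin m → Fin n) →
                  (∀ {i} → P i → Q (g i)) → (∀ {i j} → P i → P j → g i ≡ g j → i ≡ j) →
                  ∑[ i < m ] [ P? i ] ≤ ∑[ j < n ] [ Q? j ]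
count-injective {m} {n} {P = P} {Q} P? Q? g P⇒Q injective = begin
  ∑[ i < m ] [ P? i ]                                ≤⟨ sum-mono hit ⟩
  ∑[ i < m ] ∑[ j < n ] [ P? i ×-dec g i Fin.≟ j ]   ≡⟨ ∑-comm (λ i j → [ P? i ×-dec g i Fin.≟ j ]) ⟩
  ∑[ j < n ] ∑[ i < m ] [ P? i ×-dec g i Fin.≟ j ]   ≤⟨ sum-mono fibre ⟩
  ∑[ j < n ] [ Q? j ]                                ∎
  where
  open ≤-Reasoning
  hit : ∀ i → [ P? i ] ≤ ∑[ j < n ] [ P? i ×-dec g i Fin.≟ j ]
  hit i = ≤-trans ([]-mono (P? i) (P? i ×-dec g i Fin.≟ g i) (_, refl))
                  (term≤sum (λ j → [ P? i ×-dec g i Fin.≟ j ]) (g i))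
  fibre : ∀ j → ∑[ i < m ] [ P? i ×-dec g i Fin.≟ j ] ≤ [ Q? j ]
  fibre j with Q? j
  ... | yes _ = count-unique (λ i → P? i ×-dec g i Fin.≟ j)
                  λ (p , gi≡j) (q , gi′≡j) → injective p q (trans gi≡j (sym gi′≡j))
  ... | no ¬q = ≤-reflexive (sum-zero _ λ i → []-no (P? i ×-dec g i Fin.≟ j)
                  λ (p , gi≡j) → ¬q (subst Q gi≡j (P⇒Q p)))

length-filter-tabulate : ∀ {a p} {A : Set a} {P : Pred A p} (P? : Decidable P) {n} (f : Fin n → A) →
                         length (filter P? (tabulate f)) ≡ ∑[ i < n ] [ P? (f i) ]
length-filter-tabulate P? {zero}  f = refl
length-filter-tabulate P? {suc n} f with P? (f zero)
... | yes _ = cong suc (length-filter-tabulate P? (f ∘ suc))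
... | no _  = length-filter-tabulate P? (f ∘ suc)

length-filter-product : ∀ {n p} {P : Pred (Fin n × Fin n) p} (P? : Decidable P) →
  length (filter P? (cartesianProduct (allFin n) (allFin n))) ≡ ∑[ u < n ] ∑[ v < n ] [ P? (u , v) ]
length-filter-product {n} P? = go id
  where
  go : ∀ {m} (f : Fin m → Fin n) →
       -- The induction needs an arbitrary tabulation as first factor; `allFin n` is `tabulate id`.
       length (filter P? (cartesianProduct (tabulate f) (allFin n))) ≡
       ∑[ i < m ] ∑[ v < n ] [ P? (f i , v) ]
  go {zero}  f = refl
  go {suc m} f = begin
    length (filter P? (map (f zero ,_) (allFin n) ++ rest))
      ≡⟨ cong length (filter-++ P? (map (f zero ,_) (allFin n)) rest) ⟩
    length (filter P? (map (f zero ,_) (allFin n)) ++ filter P? rest)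
      ≡⟨ length-++ (filter P? (map (f zero ,_) (allFin n))) ⟩
    length (filter P? (map (f zero ,_) (allFin n))) + length (filter P? rest)
      ≡⟨ cong₂ _+_ (trans (cong (length ∘ filter P?) (map-tabulate id (f zero ,_)))
                          (length-filter-tabulate P? (f zero ,_)))
                   (go (f ∘ suc)) ⟩
    ∑[ i < suc m ] ∑[ v < n ] [ P? (f i , v) ] ∎
    where
    open ≡-Reasoning
    rest = cartesianProduct (tabulate (f ∘ suc)) (allFin n)

∑∑-distrib-+ : ∀ {m n} (f g : Fin m → Fin n → ℕ) →
  ∑[ i < m ] ∑[ j < n ] (f i j + g i j) ≡ ∑[ i < m ] ∑[ j < n ] f i j + ∑[ i < m ] ∑[ j < n ] g i j
∑∑-distrib-+ f g = trans (sum-cong-≗ λ i → ∑-distrib-+ (f i) (g i)) (∑-distrib-+ (sum ∘ f) (sum ∘ g))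

∑∑-comm : ∀ {k m n} (f : Fin k → Fin m → Fin n → ℕ) →
  ∑[ j < k ] ∑[ u < m ] ∑[ v < n ] f j u v ≡ ∑[ u < m ] ∑[ v < n ] ∑[ j < k ] f j u v
∑∑-comm f = trans (∑-comm λ j u → sum (f j u)) (sum-cong-≗ λ u → ∑-comm λ j v → f j u v)

term≤∑∑ : ∀ {m n} (f : Fin m → Fin n → ℕ) u v → f u v ≤ ∑[ u < m ] ∑[ v < n ] f u v
term≤∑∑ f u v = ≤-trans (term≤sum (f u) v) (term≤sum (sum ∘ f) u)

-- Induction with a shrinking predicate: the head pair accounts for one unit of the sum, and
-- freshness lets the tail satisfy `P` with that pair removed.
unique⇒length≤∑∑ : ∀ {n} {P : Fin n → Fin n → Set} (P? : ∀ u v → Dec (P u v)) {ps : List (Fin n × Fin n)} →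
                   Unique ps → All (uncurry P) ps → length ps ≤ ∑[ u < n ] ∑[ v < n ] [ P? u v ]
unique⇒length≤∑∑ P? [] [] = z≤n
unique⇒length≤∑∑ {n} {P} P? {(u , v) ∷ ps} (fresh ∷ unique) (p ∷ all) = begin
  1 + length ps
    ≤⟨ +-mono-≤ (≤-trans (≤-reflexive (sym ([]-yes (at? u v) (refl , refl)))) (term≤∑∑ (λ x y → [ at? x y ]) u v))
                (unique⇒length≤∑∑ rest? unique (All.zipWith (λ (q , ≢) → q , ≢ ∘ sym) (all , fresh))) ⟩
  ∑[ x < n ] ∑[ y < n ] [ at? x y ] + ∑[ x < n ] ∑[ y < n ] [ rest? x y ]
    ≡⟨ ∑∑-distrib-+ (λ x y → [ at? x y ]) (λ x y → [ rest? x y ]) ⟨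
  ∑[ x < n ] ∑[ y < n ] ([ at? x y ] + [ rest? x y ])
    ≤⟨ sum-mono (λ x → sum-mono (split x)) ⟩
  ∑[ x < n ] ∑[ y < n ] [ P? x y ] ∎
  where
  open ≤-Reasoning
  at? : ∀ x y → Dec (x ≡ u × y ≡ v)
  at? x y = x Fin.≟ u ×-dec y Fin.≟ v
  rest? : ∀ x y → Dec (P x y × (x , y) ≢ (u , v))
  rest? x y = P? x y ×-dec ¬? (Product.≡-dec Fin._≟_ Fin._≟_ (x , y) (u , v))
  split : ∀ x y → [ at? x y ] + [ rest? x y ] ≤ [ P? x y ]
  split x y with at? x y
  ... | yes (refl , refl) = ≤-reflexive
    (trans (cong suc ([]-no (rest? x y) λ (_ , ≢) → ≢ refl)) (sym ([]-yes (P? x y) p)))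
  ... | no _ = []-mono (rest? x y) (P? x y) proj₁

-- Swapping the names of the ends turns the pairs with `u < v` into those with `v < u`. Together
-- these are all pairs off the diagonal, and `P` fails on it.
handshake : ∀ {n p} {P : Fin n → Fin n → Set p} (P? : ∀ u v → Dec (P u v)) →
            (∀ {u v} → P u v → P v u) → (∀ {u} → ¬ P u u) →
            2 * ∑[ u < n ] ∑[ v < n ] [ u <? v ×-dec P? u v ] ≡ ∑[ u < n ] ∑[ v < n ] [ P? u v ]
handshake {n} {P = P} P? symmetric irreflexive = begin
  below + (below + 0)
    ≡⟨ cong (below +_) (trans (+-identityʳ below) (∑-comm λ u v → [ u <? v ×-dec P? u v ])) ⟩
  below + ∑[ u < n ] ∑[ v < n ] [ v <? u ×-dec P? v u ]
    ≡⟨ ∑∑-distrib-+ (λ u v → [ u <? v ×-dec P? u v ]) (λ u v → [ v <? u ×-dec P? v u ]) ⟨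
  ∑[ u < n ] ∑[ v < n ] ([ u <? v ×-dec P? u v ] + [ v <? u ×-dec P? v u ])
    ≡⟨ sum-cong-≗ (λ u → sum-cong-≗ (split u)) ⟩
  ∑[ u < n ] ∑[ v < n ] [ P? u v ] ∎
  where
  open ≡-Reasoning
  below = ∑[ u < n ] ∑[ v < n ] [ u <? v ×-dec P? u v ]
  split : ∀ u v → [ u <? v ×-dec P? u v ] + [ v <? u ×-dec P? v u ] ≡ [ P? u v ]
  split u v with Fin.<-cmp u v
  ... | tri< u<v _ v≮u = trans (cong₂ _+_ ([]-cong (u <? v ×-dec P? u v) (P? u v) proj₂ (u<v ,_))
                                          ([]-no (v <? u ×-dec P? v u) (v≮u ∘ proj₁)))
                               (+-identityʳ _)
  ... | tri≈ u≮v refl _ = trans (cong₂ _+_ ([]-no (u <? v ×-dec P? u v) (u≮v ∘ proj₁))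
                                           ([]-no (v <? u ×-dec P? v u) (u≮v ∘ proj₁)))
                                (sym ([]-no (P? u v) irreflexive))
  ... | tri> u≮v _ v<u = cong₂ _+_ ([]-no (u <? v ×-dec P? u v) (u≮v ∘ proj₁))
                                   ([]-cong (v <? u ×-dec P? v u) (P? u v) (symmetric ∘ proj₂) λ p → v<u , symmetric p)

-- Merging classes, orbits of permutations, spanning forests

-- The pairs are identified one at a time. A pair that is already identified costs nothing, and any
-- other lowers the number of classes by one.
merge : ∀ {f} (ps : List (Fin f × Fin f)) →
        ∃[ k ] Σ[ g ∈ (Fin f → Fin k) ]
          StrictlySurjective _≡_ g × f ≤ k + length ps × All (λ (a , b) → g a ≡ g b) ps
merge {f} [] = f , id , (λ j → j , refl) , m≤m+n f 0 , []
merge ((a , b) ∷ ps) with merge ps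
... | k , g , surj , f≤k+m , equal with g a Fin.≟ g b
...   | yes ga≡gb = k , g , surj , ≤-trans f≤k+m (+-monoʳ-≤ k (n≤1+n _)) , ga≡gb ∷ equal
...   | no ga≢gb with k
...     | zero with () ← g a
...     | suc k′ = k′ , h ∘ g , surj′ , ≤-trans f≤k+m (≤-reflexive (sym (+-suc k′ _))) ,
                   trans (h-≢ (ga≢gb ∘ sym)) (sym h-≡) ∷ All.map (cong h) equal
  where
  -- `h` deletes the label `g b` and renumbers the rest; `g b` itself goes to the new number of
  -- `g a`.
  h : Fin (suc k′) → Fin k′
  h i with g b Fin.≟ i
  ... | yes _    = punchOut (ga≢gb ∘ sym)
  ... | no gb≢i = punchOut gb≢i
  h-≡ : h (g b) ≡ punchOut (ga≢gb ∘ sym)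
  h-≡ with g b Fin.≟ g b
  ... | yes _ = refl
  ... | no ≢  = contradiction refl ≢
  h-≢ : ∀ {i} (gb≢i : g b ≢ i) → h i ≡ punchOut gb≢i
  h-≢ {i} gb≢i with g b Fin.≟ i
  ... | yes gb≡i = contradiction gb≡i gb≢i
  ... | no _     = Fin.punchOut-cong (g b) refl
  surj′ : StrictlySurjective _≡_ (h ∘ g)
  surj′ j with x , gx≡ ← surj (punchIn (g b) j) =
    x , trans (cong h gx≡) (trans (h-≢ (Fin.punchInᵢ≢i (g b) j ∘ sym)) (Fin.punchOut-punchIn (g b)))

iterate-+ : ∀ {a} {A : Set a} (f : A → A) x m n → iterate f x (m + n) ≡ iterate f (iterate f x m) n
iterate-+ f x zero    n = refl
iterate-+ f x (suc m) n = iterate-+ f (f x) m n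

iterate-injective : ∀ {a} {A : Set a} {f : A → A} → Injective _≡_ _≡_ f →
                    ∀ n {x y} → iterate f x n ≡ iterate f y n → x ≡ y
iterate-injective inj zero    eq = eq
iterate-injective inj (suc n) eq = inj (iterate-injective inj n eq)

module _ {A : Set} {N : ℕ} (code : A → Fin N) (code-injective : Injective _≡_ _≡_ code)
         {f : A → A} (f-injective : Injective _≡_ _≡_ f) where

  -- Pigeonhole: two of the iterates numbered `0` to `N` coincide, and injectivity strips the
  -- smaller exponent from both. The exponent is a successor, so that the return takes at least one
  -- step.
  period : ∀ x → ∃[ k ] iterate f x (suc k) ≡ x
  period x with Fin.pigeonhole (n<1+n N) (λ i → code (iterate f x (toℕ i)))
  ... | i , j , i<j , eq with o , i+o≡j ← m≤n⇒∃[o]m+o≡n i<j =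
    o , sym (iterate-injective f-injective (toℕ i) (begin
      iterate f x (toℕ i)                            ≡⟨ code-injective eq ⟩
      iterate f x (toℕ j)                            ≡⟨ cong (iterate f x) (sym i+o≡j) ⟩
      iterate f x (suc (toℕ i) + o)                  ≡⟨ cong (iterate f x ∘ suc) (+-comm (toℕ i) o) ⟩
      iterate f x (suc o + toℕ i)                    ≡⟨ iterate-+ f x (suc o) (toℕ i) ⟩
      iterate f (iterate f x (suc o)) (toℕ i)        ∎))
    where open ≡-Reasoning

  -- A backward step from `f y` to `y` is replaced by going forward for the rest of a period of `y`.
  orbit⇒iterate : ∀ {x y} → EqClosure (λ a b → f a ≡ b) x y → ∃[ k ] iterate f x k ≡ y
  orbit⇒iterate ε = 0 , refl
  orbit⇒iterate (fwd refl ◅ path) with k , eq ← orbit⇒iterate path = suc k , eq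
  orbit⇒iterate {x} (_◅_ {j = y} (bwd refl) path) with k , eq ← orbit⇒iterate path | l , back ← period y =
    l + k , trans (iterate-+ f x l k) (trans (cong (λ z → iterate f z k) back) eq)

least : ∀ {p} {P : Pred ℕ p} → Decidable P → ∀ n → P n → ∃[ m ] P m × (∀ {i} → i < m → ¬ P i)
least P? zero    p = 0 , p , λ ()
least P? (suc n) p with P? 0
... | yes p₀ = 0 , p₀ , λ ()
... | no ¬p₀ with m , pₘ , below ← least (P? ∘ suc) n p =
  suc m , pₘ , λ { {zero} _ → ¬p₀ ; {suc i} (s≤s i<m) → below i<m }

module _ {n : ℕ} (G : Graph (Fin n)) {S : Fin n → Set} (S? : Decidable S) where
  open Graph G

  -- Cumulative in `i`: these are the vertices at distance at most `i` from `S`, so the least level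
  -- is the distance.
  Reach : ℕ → Fin n → Set
  Reach zero    v = S v
  Reach (suc i) v = Reach i v ⊎ ∃[ u ] Adj v u × Reach i u

  reach? : ∀ i → Decidable (Reach i)
  reach? zero    v = S? v
  reach? (suc i) v = reach? i v ⊎-dec Fin.any? λ u → T? (adj v u) ×-dec reach? i u

  connected⇒reach : ∀ {u v} → EqClosure Adj u v → S v → ∃[ i ] Reach i u
  connected⇒reach ε s = 0 , s
  connected⇒reach (fwd uv ◅ path) s with i , r ← connected⇒reach path s = suc i , inj₂ (_ , uv , r)
  connected⇒reach (bwd vu ◅ path) s with i , r ← connected⇒reach path s =
    suc i , inj₂ (_ , subst T (symmetric _ _) vu , r)

  -- Breadth-first search: the depth of a vertex is its distance from `S`, and its parent is the
  -- next vertex on a shortest path.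
  spanningForest : (∀ v → ∃[ s ] EqClosure Adj v s × S s) →
                   Σ[ depth ∈ (Fin n → ℕ) ] Σ[ parent ∈ (Fin n → Fin n) ]
                     (∀ v → ¬ S v → Adj v (parent v) × depth (parent v) < depth v)
  spanningForest reachable = depth , proj₁ ∘ step , λ v → proj₂ (step v)
    where
    search : ∀ v → ∃[ m ] Reach m v × (∀ {i} → i < m → ¬ Reach i v)
    search v with s , path , s∈S ← reachable v with i , r ← connected⇒reach path s∈S =
      least (λ i → reach? i v) i r
    depth : Fin n → ℕ
    depth v = proj₁ (search v)
    depth-≤ : ∀ {i} v → Reach i v → depth v ≤ i
    depth-≤ {i} v r = ≮⇒≥ λ i<d → proj₂ (proj₂ (search v)) i<d r
    step : ∀ v → ∃[ u ] (¬ S v → Adj v u × depth u < depth v)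
    step v with search v
    ... | zero  , r                 , _     = v , contradiction r
    ... | suc i , inj₁ r            , below = contradiction r (below (n<1+n i))
    ... | suc i , inj₂ (u , vu , r) , _     = u , λ _ → vu , s≤s (depth-≤ u r)

-- Embeddings and regions of induced subgraphs

module _ {n : ℕ} {G : Graph (Fin n)} where
  open Graph G

  dart-≡ : ∀ {d e : Dart G} → source d ≡ source e → target d ≡ target e → d ≡ e
  dart-≡ {dart u v p} {dart .u .v q} refl refl = cong (dart u v) (T-irrelevant p q)

  opposite-involutive : ∀ (d : Dart G) → opposite (opposite d) ≡ d
  opposite-involutive _ = dart-≡ refl refl

  -- Embeds the darts in a finite set, as `period` and `orbit⇒iterate` require.
  code : Dart G → Fin (n * n)
  code d = combine (source d) (target d)

  code-injective : Injective _≡_ _≡_ code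
  code-injective {d} {e} eq
    with s , t ← Fin.combine-injective (source d) (target d) (source e) (target e) eq = dart-≡ s t

  dartsOf : (ps : List (Fin n × Fin n)) →
            ∃[ ds ] length ds ≤ length ps × (∀ (d : Dart G) → (source d , target d) ∈ ps → d ∈ ds)
  dartsOf [] = [] , z≤n , λ _ ()
  dartsOf ((u , v) ∷ ps) with dartsOf ps | T? (adj u v)
  ... | ds , short , covers | yes uv =
    dart u v uv ∷ ds , s≤s short ,
    λ { d (here eq) → here (dart-≡ (cong proj₁ eq) (cong proj₂ eq)) ; d (there d∈) → there (covers d d∈) }
  ... | ds , short , covers | no ¬uv =
    ds , m≤n⇒m≤1+n short ,
    λ { (dart _ _ uv) (here refl) → contradiction uv ¬uv ; d (there d∈) → covers d d∈ }

module Rotation {n : ℕ} {G : Graph (Fin n)} (rotationSystem : RotationSystem G) where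
  open Graph G
  open RotationSystem rotationSystem

  σ : Dart G → Dart G
  σ = Inverse.to rotation

  σ-injective : Injective _≡_ _≡_ σ
  σ-injective {d} {e} eq =
    trans (sym (Inverse.strictlyInverseʳ rotation d))
          (trans (cong (Inverse.from rotation) eq) (Inverse.strictlyInverseʳ rotation e))

  next-opposite : ∀ d → nextInFace (opposite d) ≡ σ d
  next-opposite d = cong σ (opposite-involutive d)

  module _ {S : Fin n → Set} where

    Inner : Dart G → Set
    Inner d = S (source d) × S (target d)

    -- The labels are regions of the subgraph induced by S: faces of G, merged across all other edges.
    record Regions {A : Set} (ℓ : Dart G → A) : Set where
      field
        ℓ-next     : ∀ d → ℓ (nextInFace d) ≡ ℓ d
        ℓ-opposite : ∀ d → ¬ Inner d → ℓ (opposite d) ≡ ℓ d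

      -- `σ d` is the dart that follows `opposite d` on its facial walk.
      ℓ-σ : ∀ d → ℓ (σ d) ≡ ℓ (opposite d)
      ℓ-σ d = trans (cong ℓ (sym (next-opposite d))) (ℓ-next (opposite d))

  module Successor {S : Fin n → Set} (S? : Decidable S) {A : Set} {ℓ : Dart G → A}
                   (regions : Regions {S} ℓ) (d : Dart G) (d-inner : Inner {S} d) where
    open Regions regions

    -- The next dart on the boundary walk of the region of `d`, found by rotating around `target d`
    -- from `opposite d`: edges that are not inner are passed without leaving the region. The walk
    -- turns back along `d` only if `target d` has no other neighbour in `S`.
    successor : ∃[ e ] source e ≡ target d × Inner {S} e × ℓ e ≡ ℓ d ×
                (∀ w → Adj (target d) w → S w → w ≢ source d → target e ≢ source d)
    successor with Fin.any? (λ w → T? (adj (target d) w) ×-dec S? w ×-dec ¬? (w Fin.≟ source d))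
    ... | yes (w , vw , w∈S , w≢) = finish (orbit⇒iterate code code-injective σ-injective
                                              (cyclic (σ (opposite d)) e (source-≡ (opposite d))))
      where
      e = dart (target d) w vw
      walk : ∀ k g → source g ≡ target d → ℓ g ≡ ℓ d → iterate σ g k ≡ e →
             ∃[ e ] source e ≡ target d × Inner {S} e × ℓ e ≡ ℓ d × target e ≢ source d
      walk zero    g s ℓg refl = g , s , (proj₂ d-inner , w∈S) , ℓg , w≢
      walk (suc k) g s ℓg eq with target g Fin.≟ source d | S? (target g)
      -- Here `g` is `opposite d`, and the turn goes on from `nextInFace d`, which has the label of
      -- `d`.
      ... | yes t | _ = walk k (σ g) (trans (source-≡ g) s) ℓσg eq
        where
        ℓσg : ℓ (σ g) ≡ ℓ d
        ℓσg = trans (cong (ℓ ∘ σ) (dart-≡ {d = g} {opposite d} s t)) (ℓ-next d)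
      ... | no t≢ | yes t∈S = g , s , (subst S (sym s) (proj₂ d-inner) , t∈S) , ℓg , t≢
      ... | no _  | no t∉S  = walk k (σ g) (trans (source-≡ g) s)
                                (trans (ℓ-σ g) (trans (ℓ-opposite g (t∉S ∘ proj₂)) ℓg)) eq
      finish : ∃[ k ] iterate σ (σ (opposite d)) k ≡ e → _
      finish (k , eq) with f , s , inner , ℓf , t≢ ← walk k (σ (opposite d)) (source-≡ (opposite d)) (ℓ-next d) eq =
        f , s , inner , ℓf , λ _ _ _ _ → t≢
    -- No neighbour of `target d` other than `source d` lies in `S`, so a full turn back to
    -- `opposite d` crosses no inner edge.
    ... | no none with k , eq ← period code code-injective σ-injective (opposite d) =
      opposite d , refl , (proj₂ d-inner , proj₁ d-inner) ,
      walk k (σ (opposite d)) (source-≡ (opposite d)) (ℓ-next d) eq ,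
      λ w vw w∈S w≢ → contradiction (w , vw , w∈S , w≢) none
      where
      walk : ∀ k g → source g ≡ target d → ℓ g ≡ ℓ d → iterate σ g k ≡ opposite d → ℓ (opposite d) ≡ ℓ d
      walk zero    g s ℓg refl = ℓg
      walk (suc k) g s ℓg eq with target g Fin.≟ source d
      ... | yes t = trans (cong ℓ (dart-≡ {d = opposite d} {g} (sym s) (sym t))) ℓg
      ... | no t≢ = walk k (σ g) (trans (source-≡ g) s)
                      (trans (ℓ-σ g) (trans (ℓ-opposite g λ inner →
                        none (target g , subst (λ v → Adj v (target g)) s (adjacent g) , proj₂ inner , t≢)) ℓg)) eq

  module _ {X : Fin n → Set} (X? : Decidable X) (parent : Fin n → Fin n) where

    Tree : Fin n → Fin n → Set
    Tree u v = ¬ X u × parent u ≡ v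

    tree? : ∀ u v → Dec (Tree u v)
    tree? u v = ¬? (X? u) ×-dec (parent u Fin.≟ v)

  module _ {S X : Fin n → Set} (X? : Decidable X) (S⊆X : ∀ {v} → S v → X v)
           (depth : Fin n → ℕ) (parent : Fin n → Fin n)
           (descends : ∀ v → ¬ X v → Adj v (parent v) × depth (parent v) < depth v) where
    private
      Parental : Fin n → Fin n → Set
      Parental = Tree X? parent

    -- Turning around a vertex outside X crosses every incident edge but the one to its parent,
    -- so the two sides of that edge are merged as soon as those of all other edges are.
    treeRegions : ∀ {A : Set} {ℓ : Dart G → A} → (∀ d → ℓ (nextInFace d) ≡ ℓ d) →
                  (∀ d → ¬ Inner {S} d → ¬ Parental (source d) (target d) → ¬ Parental (target d) (source d) →
                    ℓ (opposite d) ≡ ℓ d) →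
                  Regions {S} ℓ
    treeRegions {ℓ = ℓ} ℓ-next ℓ-nontree = record { ℓ-next = ℓ-next ; ℓ-opposite = ℓ-opposite }
      where
      -- A crude upper bound for every depth. `tree` and `child` recurse away from the roots of the
      -- forest, and `t` covers the gap between the current depth and this bound, so it drops with
      -- each child and cannot run out.
      bound : ℕ
      bound = sum depth
      tree : ∀ t d → bound ≤ depth (source d) + t → Parental (source d) (target d) → ℓ (opposite d) ≡ ℓ d
      tree t d bounded (z∉X , pz≡)
        with k , eq ← period code code-injective σ-injective d =
        sym (trans (walk k (σ d) (source-≡ d) refl eq) (trans (cong ℓ (sym (next-opposite d))) (ℓ-next (opposite d))))
        where
        child : ∀ t g → bound ≤ depth (source d) + t → source g ≡ source d →
                Parental (target g) (source g) → ℓ (opposite g) ≡ ℓ g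
        child zero g bounded s (t∉X , pt≡) = contradiction
          (begin-strict
            bound                ≤⟨ bounded ⟩
            depth (source d) + 0 ≡⟨ +-identityʳ _ ⟩
            depth (source d)     ≡⟨ cong depth (trans (sym s) (sym pt≡)) ⟩
            depth (parent (target g)) <⟨ proj₂ (descends (target g) t∉X) ⟩
            depth (target g)     ≤⟨ term≤sum depth (target g) ⟩
            bound ∎)
          (<-irrefl refl)
          where open ≤-Reasoning
        child (suc t) g bounded s (t∉X , pt≡) =
          trans (sym (tree t (opposite g)
            (begin
              bound                    ≤⟨ bounded ⟩
              depth (source d) + suc t ≡⟨ +-suc _ t ⟩
              suc (depth (source d)) + t ≤⟨ +-monoˡ-≤ t (subst (λ v → suc (depth v) ≤ depth (target g))
                                              (trans pt≡ s) (proj₂ (descends (target g) t∉X))) ⟩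
              depth (target g) + t     ∎)
            (t∉X , pt≡)))
            (cong ℓ (opposite-involutive g))
          where open ≤-Reasoning
        walk : ∀ k g → source g ≡ source d → ℓ g ≡ ℓ (σ d) → iterate σ g k ≡ d → ℓ d ≡ ℓ (σ d)
        walk zero    g s ℓg refl = ℓg
        walk (suc k) g s ℓg eq with target g Fin.≟ target d
        ... | yes t = trans (cong ℓ (dart-≡ {d = d} {g} (sym s) (sym t))) ℓg
        ... | no t≢ = walk k (σ g) (trans (source-≡ g) s)
                        (trans (trans (cong ℓ (sym (next-opposite g))) (ℓ-next (opposite g))) (trans across ℓg)) eq
          where
          across : ℓ (opposite g) ≡ ℓ g
          across with tree? X? parent (target g) (source g)
          ... | yes tg = child t g bounded s tg
          -- `g` leaves a vertex outside `X`, hence outside `S`, and does not lead to its parent,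
          -- which is `target d`.
          ... | no ¬tg = ℓ-nontree g (λ inner → z∉X (subst X s (S⊆X (proj₁ inner))))
                           (λ (_ , p≡) → t≢ (trans (sym p≡) (trans (cong parent s) pz≡))) ¬tg
      ℓ-opposite : ∀ d → ¬ Inner {S} d → ℓ (opposite d) ≡ ℓ d
      ℓ-opposite d ¬inner with tree? X? parent (source d) (target d) | tree? X? parent (target d) (source d)
      ... | yes td | _      = tree bound d (m≤n+m bound _) td
      ... | no _   | yes td = trans (sym (tree bound (opposite d) (m≤n+m bound _) td)) (cong ℓ (opposite-involutive d))
      ... | no ¬td | no ¬to = ℓ-nontree d ¬inner ¬td ¬to

-- Euler's bound for an induced subgraph

module _ {n : ℕ} {G : Graph (Fin n)} where
  open Graph G

  isolated-connected : ∀ {u v} → (∀ w → ¬ Adj u w) → EqClosure Adj u v → u ≡ v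
  isolated-connected iso ε = refl
  isolated-connected iso (fwd uw ◅ _) = contradiction uw (iso _)
  isolated-connected iso (bwd wu ◅ _) = contradiction (subst T (symmetric _ _) wu) (iso _)

edgeCount≡ : ∀ {n} (G : Graph (Fin n)) → let open Graph G in
             2 * edgeCount G ≡ ∑[ u < n ] ∑[ v < n ] [ T? (adj u v) ]
edgeCount≡ G = trans (cong (2 *_) (length-filter-product λ (u , v) → (u <? v) ×-dec T? (adj u v)))
                     (handshake (λ u v → T? (adj u v)) (λ {u} {v} → subst T (symmetric u v))
                                (λ {u} → subst T (irreflexive u)))
  where open Graph G

module Euler {n : ℕ} {G : Graph (Fin n)} (planar : Planar G) {S : Fin n → Set} (S? : Decidable S) where
  open Graph G
  open Planar planar
  open RotationSystem rotationSystem
  open Rotation rotationSystem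

  order : ℕ
  order = ∑[ v < n ] [ S? v ]

  inner? : ∀ u v → Dec (Adj u v × S u × S v)
  inner? u v = T? (adj u v) ×-dec S? u ×-dec S? v

  degreeSum : ℕ
  degreeSum = ∑[ u < n ] ∑[ v < n ] [ inner? u v ]

  -- Every region of the subgraph induced by S has boundary walks of total length at least ρ.
  RegionsSpread : ℕ → Set
  RegionsSpread ρ = ∀ {k} {ℓ : Dart G → Fin k} → Regions {S} ℓ → ∀ d → Inner {S} d →
                    ∃[ ds ] Unique ds × length ds ≡ ρ × All (λ e → Inner {S} e × ℓ e ≡ ℓ d) ds

  private
    component : Fin n → Fin c
    component = Bijection.to componentCount

    connected : ∀ {u v} → component u ≡ component v → EqClosure Adj u v
    connected = Bijection.injective componentCount

    representative : Fin c → Fin n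
    representative i = proj₁ (Bijection.surjective componentCount i)

    component-representative : ∀ i → component (representative i) ≡ i
    component-representative i = proj₂ (Bijection.surjective componentCount i) ε

    face : Dart G → Fin f
    face = Bijection.to facialWalks

    face-next : ∀ d → face (nextInFace d) ≡ face d
    face-next d = sym (Bijection.cong facialWalks (EqClosure.return refl))

    isolated? : Decidable (λ v → ∀ w → ¬ Adj v w)
    isolated? v = Fin.all? (λ w → ¬? (T? (adj v w)))

    isolatedCount≡ : isolatedCount G ≡ ∑[ v < n ] [ isolated? v ]
    isolatedCount≡ = length-filter-tabulate isolated? id

  module _ (e₀ : Dart G) (e₀-inner : Inner {S} e₀) where
    private
      c₀ : Fin c
      c₀ = component (source e₀)

      -- One root in every component but that of e₀, from which the forest is grown together with S.
      Root : Fin n → Set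
      Root v = v ≡ representative (component v) × component v ≢ c₀

      root? : Decidable Root
      root? v = v Fin.≟ representative (component v) ×-dec ¬? (component v Fin.≟ c₀)

      X : Fin n → Set
      X v = S v ⊎ Root v

      X? : Decidable X
      X? v = S? v ⊎-dec root? v

      all-but-c₀ : ∑[ i < c ] [ ¬? (i Fin.≟ c₀) ] + 1 ≤ c
      all-but-c₀ = begin
        ∑[ i < c ] [ ¬? (i Fin.≟ c₀) ] + 1
          ≡⟨ cong (∑[ i < c ] [ ¬? (i Fin.≟ c₀) ] +_) (sym ([]-yes (c₀ Fin.≟ c₀) refl)) ⟩
        ∑[ i < c ] [ ¬? (i Fin.≟ c₀) ] + [ c₀ Fin.≟ c₀ ]
          ≤⟨ +-monoʳ-≤ (∑[ i < c ] [ ¬? (i Fin.≟ c₀) ]) (term≤sum (λ i → [ i Fin.≟ c₀ ]) c₀) ⟩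
        ∑[ i < c ] [ ¬? (i Fin.≟ c₀) ] + ∑[ i < c ] [ i Fin.≟ c₀ ]
          ≡⟨ ∑-distrib-+ (λ i → [ ¬? (i Fin.≟ c₀) ]) (λ i → [ i Fin.≟ c₀ ]) ⟨
        ∑[ i < c ] ([ ¬? (i Fin.≟ c₀) ] + [ i Fin.≟ c₀ ])
          ≤⟨ sum-mono split ⟩
        ∑[ i < c ] 1
          ≡⟨ trans (sum-const c 1) (*-identityʳ c) ⟩
        c ∎
        where
        open ≤-Reasoning
        split : ∀ i → [ ¬? (i Fin.≟ c₀) ] + [ i Fin.≟ c₀ ] ≤ 1
        split i with i Fin.≟ c₀
        ... | yes _ = ≤-refl
        ... | no _  = ≤-refl

      -- A root is determined by its component, and `c₀` contains none.
      X-count : ∑[ v < n ] [ X? v ] + 1 ≤ order + c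
      X-count = begin
        ∑[ v < n ] [ X? v ] + 1
          ≤⟨ +-monoˡ-≤ 1 (sum-mono split) ⟩
        ∑[ v < n ] ([ S? v ] + [ root? v ]) + 1
          ≡⟨ cong (_+ 1) (∑-distrib-+ (λ v → [ S? v ]) (λ v → [ root? v ])) ⟩
        order + ∑[ v < n ] [ root? v ] + 1
          ≡⟨ +-assoc order _ 1 ⟩
        order + (∑[ v < n ] [ root? v ] + 1)
          ≤⟨ +-monoʳ-≤ order (≤-trans (+-monoˡ-≤ 1 roots) all-but-c₀) ⟩
        order + c ∎
        where
        open ≤-Reasoning
        split : ∀ v → [ X? v ] ≤ [ S? v ] + [ root? v ]
        split v with S? v | root? v
        ... | yes _ | _     = s≤s z≤n
        ... | no _  | yes _ = ≤-refl
        ... | no _  | no _  = ≤-refl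
        roots : ∑[ v < n ] [ root? v ] ≤ ∑[ i < c ] [ ¬? (i Fin.≟ c₀) ]
        roots = count-injective root? (λ i → ¬? (i Fin.≟ c₀)) component proj₂
                  (λ (u≡ , _) (v≡ , _) same → trans u≡ (trans (cong representative same) (sym v≡)))

      reachable : ∀ v → ∃[ s ] EqClosure Adj v s × X s
      reachable v with component v Fin.≟ c₀
      ... | yes v∈c₀ = source e₀ , connected v∈c₀ , inj₁ (proj₁ e₀-inner)
      ... | no v∉c₀  = r , connected (sym same) , inj₂ (cong representative (sym same) , v∉c₀ ∘ trans (sym same))
        where
        r = representative (component v)
        same : component r ≡ component v
        same = component-representative (component v)

      forest = spanningForest G X? reachable
      depth  = proj₁ forest
      parent = proj₁ (proj₂ forest)
      descends = proj₂ (proj₂ forest)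

      Tree′ : Fin n → Fin n → Set
      Tree′ = Tree X? parent

      tree′? : ∀ u v → Dec (Tree′ u v)
      tree′? = tree? X? parent

      -- The edges whose two sides are merged explicitly; those of the forest are left to
      -- `treeRegions`.
      Crossed : Fin n → Fin n → Set
      Crossed u v = Adj u v × ¬ (S u × S v) × ¬ Tree′ u v × ¬ Tree′ v u

      crossed? : ∀ u v → Dec (Crossed u v)
      crossed? u v = T? (adj u v) ×-dec ¬? (S? u ×-dec S? v) ×-dec ¬? (tree′? u v) ×-dec ¬? (tree′? v u)

      non-X : ℕ
      non-X = ∑[ v < n ] [ ¬? (X? v) ]

      X-split : non-X + ∑[ v < n ] [ X? v ] ≡ n
      X-split = begin
        non-X + ∑[ v < n ] [ X? v ]              ≡⟨ ∑-distrib-+ (λ v → [ ¬? (X? v) ]) (λ v → [ X? v ]) ⟨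
        ∑[ v < n ] ([ ¬? (X? v) ] + [ X? v ])    ≡⟨ sum-cong-≗ one ⟩
        ∑[ v < n ] 1                             ≡⟨ trans (sum-const n 1) (*-identityʳ n) ⟩
        n                                        ∎
        where
        open ≡-Reasoning
        one : ∀ v → [ ¬? (X? v) ] + [ X? v ] ≡ 1
        one v with X? v
        ... | yes _ = refl
        ... | no _  = refl

      tree-count : ∑[ u < n ] ∑[ v < n ] [ tree′? u v ] ≡ non-X
      tree-count = sum-cong-≗ λ u → count-fibre (¬? (X? u)) (parent u)

      crossings : ℕ
      crossings = ∑[ u < n ] ∑[ v < n ] [ (u <? v) ×-dec crossed? u v ]

      -- Crossed edges, edges inside `S` and forest edges are three disjoint kinds of edges, and
      -- every vertex outside `X` owns one forest edge. Counting ordered pairs doubles all terms.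
      crossings-count : 2 * crossings + degreeSum + 2 * non-X ≤ 2 * edgeCount G
      crossings-count = begin
        2 * crossings + degreeSum + 2 * non-X
          ≡⟨ cong₂ (λ a b → a + degreeSum + b)
               (handshake crossed?
                 (λ {u} {v} (uv , ¬in , ¬t , ¬t′) → subst T (symmetric u v) uv , (λ (a , b) → ¬in (b , a)) , ¬t′ , ¬t)
                 (λ {u} (uu , _) → subst T (irreflexive u) uu))
               (trans (cong (non-X +_) (+-identityʳ non-X))
                      (cong₂ _+_ (sym tree-count) (trans (sym tree-count) (∑-comm λ u v → [ tree′? u v ])))) ⟩
        ΣΣ C + ΣΣ I + (ΣΣ P + ΣΣ P′)
          ≡⟨ cong₂ _+_ (∑∑-distrib-+ C I) (∑∑-distrib-+ P P′) ⟨
        ΣΣ (λ u v → C u v + I u v) + ΣΣ (λ u v → P u v + P′ u v)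
          ≡⟨ ∑∑-distrib-+ (λ u v → C u v + I u v) (λ u v → P u v + P′ u v) ⟨
        ΣΣ (λ u v → C u v + I u v + (P u v + P′ u v))
          ≤⟨ sum-mono (λ u → sum-mono (split u)) ⟩
        ∑[ u < n ] ∑[ v < n ] [ T? (adj u v) ]
          ≡⟨ edgeCount≡ G ⟨
        2 * edgeCount G ∎
        where
        open ≤-Reasoning
        ΣΣ : (Fin n → Fin n → ℕ) → ℕ
        ΣΣ h = ∑[ u < n ] ∑[ v < n ] h u v
        C I P P′ : Fin n → Fin n → ℕ
        C u v = [ crossed? u v ]
        I u v = [ inner? u v ]
        P u v = [ tree′? u v ]
        P′ u v = [ tree′? v u ]
        tree⇒adj : ∀ {u v} → Tree′ u v → Adj u v
        tree⇒adj {u} (u∉X , refl) = proj₁ (descends u u∉X)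
        split : ∀ u v → C u v + I u v + (P u v + P′ u v) ≤ [ T? (adj u v) ]
        split u v = ≤-trans
          (+-mono-≤ ([]-disjoint (crossed? u v) (inner? u v) (crossed? u v ⊎-dec inner? u v) inj₁ inj₂
                       λ (_ , ¬in , _) (_ , in′) → ¬in in′)
                    ([]-disjoint (tree′? u v) (tree′? v u) (tree′? u v ⊎-dec tree′? v u) inj₁ inj₂
                       -- Two vertices cannot be each other's parents, as each would be deeper than
                       -- the other.
                       λ (u∉X , pu≡v) (v∉X , pv≡u) → <-asym
                         (subst (λ w → depth w < depth u) pu≡v (proj₂ (descends u u∉X)))
                         (subst (λ w → depth w < depth v) pv≡u (proj₂ (descends v v∉X)))))
          ([]-disjoint (crossed? u v ⊎-dec inner? u v) (tree′? u v ⊎-dec tree′? v u) (T? (adj u v))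
             [ proj₁ , proj₁ ]′
             [ tree⇒adj , subst T (symmetric v u) ∘ tree⇒adj ]′
             [ (λ (_ , _ , ¬t , ¬t′) → [ ¬t , ¬t′ ]′)
             , (λ (_ , u∈S , v∈S) → [ (λ (u∉X , _) → u∉X (inj₁ u∈S)) , (λ (v∉X , _) → v∉X (inj₁ v∈S)) ]′) ]′)

      -- Twice Euler's inequality: edges plus 2 plus `b` are at most vertices plus `k`. Merging
      -- trades faces for crossed edges, the vertices outside `X` cancel against the forest edges,
      -- and the components are absorbed by the bounds on the roots and on `b`.
      euler′ : ∀ {k m b} → f ≤ k + m → m ≤ crossings → b + isolatedCount G + 1 ≤ c →
               degreeSum + 4 + 2 * b ≤ 2 * order + 2 * k
      euler′ {k} {m} {b} f≤ m≤ b≤ = +-cancelʳ-≤ slack _ _ (begin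
        degreeSum + 4 + 2 * b + slack
          ≡⟨ lhs degreeSum b f crossings non-X n iso (edgeCount G) c x ⟩
        2 * f + (2 * crossings + degreeSum + 2 * non-X) + 2 * (edgeCount G + 2 * c)
          + 2 * (x + 1) + 2 * (b + iso + 1) + 2 * n
          ≤⟨ +-mono-≤ (+-mono-≤ (+-mono-≤ (+-mono-≤ (+-mono-≤
               (*-monoʳ-≤ 2 (≤-trans f≤ (+-monoʳ-≤ k m≤)))
               crossings-count)
               (*-monoʳ-≤ 2 (≤-reflexive (sym euler))))
               (*-monoʳ-≤ 2 X-count))
               (*-monoʳ-≤ 2 b≤))
               (*-monoʳ-≤ 2 (≤-reflexive (sym X-split))) ⟩
        2 * (k + crossings) + 2 * edgeCount G + 2 * (n + (f + iso)) + 2 * (order + c) + 2 * c + 2 * (non-X + x)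
          ≡⟨ rhs order k f crossings non-X n iso (edgeCount G) c x ⟩
        2 * order + 2 * k + slack ∎)
        where
        open ≤-Reasoning
        iso = isolatedCount G
        x = ∑[ v < n ] [ X? v ]
        -- The terms common to both sides once all the inequalities are added.
        slack = 2 * f + 2 * crossings + 2 * non-X + 2 * n + 2 * iso + 2 * edgeCount G + 4 * c + 2 * x
        lhs : ∀ D b f m z n i e c x → D + 4 + 2 * b + (2 * f + 2 * m + 2 * z + 2 * n + 2 * i + 2 * e + 4 * c + 2 * x)
              ≡ 2 * f + (2 * m + D + 2 * z) + 2 * (e + 2 * c) + 2 * (x + 1) + 2 * (b + i + 1) + 2 * n
        lhs = solve-∀
        rhs : ∀ s k f m z n i e c x → 2 * (k + m) + 2 * e + 2 * (n + (f + i)) + 2 * (s + c) + 2 * c + 2 * (z + x)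
              ≡ 2 * s + 2 * k + (2 * f + 2 * m + 2 * z + 2 * n + 2 * i + 2 * e + 4 * c + 2 * x)
        rhs = solve-∀

      below? : Decidable (λ ((u , v) : Fin n × Fin n) → u Fin.< v × Crossed u v)
      below? (u , v) = (u <? v) ×-dec crossed? u v

      sides : Dart G → Fin f × Fin f
      sides d = face d , face (opposite d)

      -- Only darts with increasing ends are listed for `merge`, so every crossed edge is charged
      -- once; the reverse darts follow by symmetry.
      regions : ∃[ k ] Σ[ ℓ ∈ (Dart G → Fin k) ]
                  StrictlySurjective _≡_ ℓ × Regions {S} ℓ × ∃[ m ] f ≤ k + m × m ≤ crossings
      regions
        with ds , short , covers ← dartsOf {G = G} (filter below? (cartesianProduct (allFin n) (allFin n)))
        with k , g , surj , f≤ , merged ← merge (map sides ds) =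
        k , g ∘ face , surjective , treeRegions X? inj₁ depth parent descends (cong g ∘ face-next) across ,
        length ds , subst (λ l → f ≤ k + l) (length-map sides ds) f≤ ,
        ≤-trans short (≤-reflexive (length-filter-product below?))
        where
        surjective : StrictlySurjective _≡_ (g ∘ face)
        surjective j with i , gi≡j ← surj j with d , d↦i ← Bijection.surjective facialWalks i =
          d , trans (cong g (d↦i ε)) gi≡j
        listed : ∀ d → source d Fin.< target d → Crossed (source d) (target d) → g (face d) ≡ g (face (opposite d))
        listed d <t crossed = All.lookup (All.map⁻ merged)
          (covers d (∈-filter⁺ below? (∈-cartesianProduct⁺ (∈-allFin _) (∈-allFin _)) (<t , crossed)))
        across : ∀ d → ¬ Inner {S} d → ¬ Tree′ (source d) (target d) → ¬ Tree′ (target d) (source d) →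
                 g (face (opposite d)) ≡ g (face d)
        across d ¬inner ¬t ¬t′ with Fin.<-cmp (source d) (target d)
        ... | tri< <t _ _ = sym (listed d <t (adjacent d , ¬inner , ¬t , ¬t′))
        ... | tri≈ _ s≡t _ = contradiction
          (subst (Adj (source d)) (sym s≡t) (adjacent d)) (subst T (irreflexive (source d)))
        ... | tri> _ _ t< = trans
          (listed (opposite d) t< (adjacent (opposite d) , (λ (a , b) → ¬inner (b , a)) , ¬t′ , ¬t))
          (cong (g ∘ face) (opposite-involutive d))

    module _ {k} {ℓ : Dart G → Fin k} (surjective : StrictlySurjective _≡_ ℓ) (region : Regions {S} ℓ) where
      open Regions region

      InRegion : Fin k → Fin n → Fin n → Set
      InRegion j u v = Σ[ uv ∈ Adj u v ] S u × S v × ℓ (dart u v uv) ≡ j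

      inRegion? : ∀ j u v → Dec (InRegion j u v)
      inRegion? j u v with T? (adj u v)
      ... | no ¬uv = no (¬uv ∘ proj₁)
      ... | yes uv with S? u ×-dec S? v ×-dec ℓ (dart u v uv) Fin.≟ j
      ...   | yes p = yes (uv , p)
      ...   | no ¬p = no λ (uv′ , p) → ¬p (subst (λ a → S u × S v × ℓ (dart u v a) ≡ j) (T-irrelevant uv′ uv) p)

      -- Having a boundary within the subgraph induced by `S`. Only such regions can be charged to
      -- inner darts.
      Bounded : Fin k → Set
      Bounded j = ∃[ u ] ∃[ v ] InRegion j u v

      bounded? : Decidable Bounded
      bounded? j = Fin.any? λ u → Fin.any? λ v → inRegion? j u v

      bounded : ∀ {j} d → Inner {S} d → ℓ d ≡ j → Bounded j
      bounded d (u∈S , v∈S) eq = _ , _ , adjacent d , u∈S , v∈S , eq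

      unbounded : ℕ
      unbounded = ∑[ j < k ] [ ¬? (bounded? j) ]

      module _ {j} (¬bounded : ¬ Bounded j) where
        across : ∀ d → ℓ d ≡ j → ℓ (opposite d) ≡ j
        across d ℓd≡j = trans (ℓ-opposite d λ inner → ¬bounded (bounded d inner ℓd≡j)) ℓd≡j

        rotate : ∀ {d e} → EqClosure (λ a b → σ a ≡ b) d e → ℓ d ≡ j → ℓ e ≡ j
        rotate ε ℓd≡j = ℓd≡j
        rotate (_◅_ {i = d} (fwd refl) path) ℓd≡j = rotate path (trans (ℓ-σ d) (across d ℓd≡j))
        rotate (_◅_ {j = e} (bwd refl) path) ℓσe≡j = rotate path
          (trans (cong ℓ (sym (opposite-involutive e))) (across (opposite e) (trans (sym (ℓ-σ e)) ℓσe≡j)))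

        -- No inner dart has the label `j`, so rotating and passing to the opposite dart both
        -- preserve this label, and it fills every component that it meets.
        spread : ∀ {u v} → EqClosure Adj u v → ∀ d e → source d ≡ u → source e ≡ v → ℓ d ≡ j → ℓ e ≡ j
        spread ε d e refl s ℓd≡j = rotate (cyclic d e (sym s)) ℓd≡j
        spread (fwd uw ◅ path) d e s t ℓd≡j =
          spread path (opposite d′) e refl t (across d′ (rotate (cyclic d d′ s) ℓd≡j))
          where d′ = dart _ _ uw
        spread (bwd wu ◅ path) d e s t ℓd≡j =
          spread path (opposite d′) e refl t (across d′ (rotate (cyclic d d′ s) ℓd≡j))
          where d′ = opposite (dart _ _ wu)

      private
        home : Fin k → Fin c
        home j = component (source (proj₁ (surjective j)))

        Hosts Isolated : Fin c → Set
        Hosts i    = ∃[ j ] ¬ Bounded j × home j ≡ i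
        Isolated i = ∃[ v ] (∀ w → ¬ Adj v w) × component v ≡ i

        hosts? : Decidable Hosts
        hosts? i = Fin.any? λ j → ¬? (bounded? j) ×-dec home j Fin.≟ i

        isolatedComponent? : Decidable Isolated
        isolatedComponent? i = Fin.any? λ v → isolated? v ×-dec component v Fin.≟ i

      -- Unbounded regions, isolated vertices and e₀ lie in pairwise distinct components.
      unbounded-count : unbounded + isolatedCount G + 1 ≤ c
      unbounded-count = begin
        unbounded + isolatedCount G + 1
          ≤⟨ +-mono-≤ (+-mono-≤ hosts isolateds) (≤-trans (≤-reflexive (sym ([]-yes (c₀ Fin.≟ c₀) refl)))
                                                         (term≤sum (λ i → [ i Fin.≟ c₀ ]) c₀)) ⟩
        ∑[ i < c ] [ hosts? i ] + ∑[ i < c ] [ isolatedComponent? i ] + ∑[ i < c ] [ i Fin.≟ c₀ ]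
          ≡⟨ cong (_+ ∑[ i < c ] [ i Fin.≟ c₀ ]) (∑-distrib-+ (λ i → [ hosts? i ]) (λ i → [ isolatedComponent? i ])) ⟨
        ∑[ i < c ] ([ hosts? i ] + [ isolatedComponent? i ]) + ∑[ i < c ] [ i Fin.≟ c₀ ]
          ≡⟨ ∑-distrib-+ (λ i → [ hosts? i ] + [ isolatedComponent? i ]) (λ i → [ i Fin.≟ c₀ ]) ⟨
        ∑[ i < c ] ([ hosts? i ] + [ isolatedComponent? i ] + [ i Fin.≟ c₀ ])
          ≤⟨ sum-mono disjoint ⟩
        ∑[ i < c ] 1
          ≡⟨ trans (sum-const c 1) (*-identityʳ c) ⟩
        c ∎
        where
        open ≤-Reasoning
        hosts : unbounded ≤ ∑[ i < c ] [ hosts? i ]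
        -- By `spread`, two unbounded labels at home in the same component are equal.
        hosts = count-injective (λ j → ¬? (bounded? j)) hosts? home (λ ¬b → _ , ¬b , refl)
          λ {j} {j′} ¬b ¬b′ same → trans
            (sym (spread ¬b (connected same) _ (proj₁ (surjective j′)) refl refl (proj₂ (surjective j))))
            (proj₂ (surjective j′))
        isolateds : isolatedCount G ≤ ∑[ i < c ] [ isolatedComponent? i ]
        isolateds = ≤-trans (≤-reflexive isolatedCount≡)
          (count-injective isolated? isolatedComponent? component (λ iso → _ , iso , refl) λ iso _ same →
            isolated-connected {G = G} iso (connected same))
        isolated-dart : ∀ {v} → (∀ w → ¬ Adj v w) → ∀ d → component v ≢ component (source d)
        isolated-dart iso d same with refl ← isolated-connected {G = G} iso (connected same) =
          iso (target d) (adjacent d)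
        disjoint : ∀ i → [ hosts? i ] + [ isolatedComponent? i ] + [ i Fin.≟ c₀ ] ≤ 1
        disjoint i = ≤-trans
          (+-monoˡ-≤ [ i Fin.≟ c₀ ]
            ([]-disjoint (hosts? i) (isolatedComponent? i) (hosts? i ⊎-dec isolatedComponent? i) inj₁ inj₂
              λ { (j , _ , refl) (v , iso , same) → isolated-dart iso (proj₁ (surjective j)) same }))
          (≤-trans
            ([]-disjoint (hosts? i ⊎-dec isolatedComponent? i) (i Fin.≟ c₀)
              ((hosts? i ⊎-dec isolatedComponent? i) ⊎-dec i Fin.≟ c₀) inj₁ inj₂
              λ { (inj₁ (j , ¬b , same)) refl → ¬b (bounded e₀ e₀-inner
                    (spread ¬b (connected same) _ e₀ refl refl (proj₂ (surjective j))))
                ; (inj₂ (v , iso , same)) refl → isolated-dart iso e₀ same })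
            ([]≤1 ((hosts? i ⊎-dec isolatedComponent? i) ⊎-dec i Fin.≟ c₀)))

      -- Double counting of inner darts by label: each dart has one label, every bounded label is
      -- carried by at least `ρ` darts, and the last term pays for the unbounded labels.
      boundary-count : ∀ ρ → RegionsSpread ρ → ρ * k ≤ degreeSum + ρ * unbounded
      boundary-count ρ ρ-spread = begin
        ρ * k
          ≡⟨ trans (*-comm ρ k) (sym (sum-const k ρ)) ⟩
        ∑[ j < k ] ρ
          ≤⟨ sum-mono boundary ⟩
        ∑[ j < k ] (∑[ u < n ] ∑[ v < n ] [ inRegion? j u v ] + ρ * [ ¬? (bounded? j) ])
          ≡⟨ ∑-distrib-+ (λ j → ∑[ u < n ] ∑[ v < n ] [ inRegion? j u v ]) (λ j → ρ * [ ¬? (bounded? j) ]) ⟩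
        ∑[ j < k ] ∑[ u < n ] ∑[ v < n ] [ inRegion? j u v ] + ∑[ j < k ] (ρ * [ ¬? (bounded? j) ])
          ≡⟨ cong₂ _+_ (∑∑-comm (λ j u v → [ inRegion? j u v ])) (sym (*-distribˡ-sum ρ (λ j → [ ¬? (bounded? j) ]))) ⟩
        ∑[ u < n ] ∑[ v < n ] ∑[ j < k ] [ inRegion? j u v ] + ρ * unbounded
          ≤⟨ +-monoˡ-≤ (ρ * unbounded) (sum-mono λ u → sum-mono (fibre u)) ⟩
        degreeSum + ρ * unbounded ∎
        where
        open ≤-Reasoning
        fibre : ∀ u v → ∑[ j < k ] [ inRegion? j u v ] ≤ [ inner? u v ]
        fibre u v with inner? u v
        ... | yes _ = count-unique (λ j → inRegion? j u v)
                        λ (p , _ , _ , eq) (q , _ , _ , eq′) →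
                          trans (sym eq) (trans (cong (ℓ ∘ dart u v) (T-irrelevant p q)) eq′)
        ... | no ¬inner = ≤-reflexive (sum-zero _ λ j →
                        []-no (inRegion? j u v) λ (p , u∈S , v∈S , _) → ¬inner (p , u∈S , v∈S))
        boundary : ∀ j → ρ ≤ ∑[ u < n ] ∑[ v < n ] [ inRegion? j u v ] + ρ * [ ¬? (bounded? j) ]
        boundary j with bounded? j
        ... | no _ = ≤-trans (≤-reflexive (sym (*-identityʳ ρ))) (m≤n+m (ρ * 1) _)
        ... | yes (u , v , uv , u∈S , v∈S , refl)
          with ds , unique , refl , inside ← ρ-spread region (dart u v uv) (u∈S , v∈S) =
          ≤-trans (≤-trans (≤-reflexive (sym (length-map ends ds)))
                           (unique⇒length≤∑∑ (inRegion? j)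
                              (Unique.map⁺ (λ eq → dart-≡ (cong proj₁ eq) (cong proj₂ eq)) unique)
                              (All.map⁺ (All.map (λ { {dart _ _ p} ((a , b) , eq) → p , a , b , eq }) inside))))
                  (m≤m+n _ _)
          where
          ends : Dart G → Fin n × Fin n
          ends d = source d , target d

    -- Eliminates the number of regions between `euler′` and `boundary-count`; the unbounded regions
    -- cancel. As `degreeSum` is twice the number e of edges, `ρ = 3` gives e ≤ 3s - 6 and `ρ = 4`
    -- gives e ≤ 2s - 4, where s is `order`.
    euler-bound : ∀ ρ → RegionsSpread ρ → ρ * (degreeSum + 4) ≤ 2 * ρ * order + 2 * degreeSum
    euler-bound ρ ρ-spread with k , ℓ , surjective , region , m , f≤ , m≤ ← regions =
      +-cancelʳ-≤ (2 * ρ * b) _ _ (begin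
        ρ * (degreeSum + 4) + 2 * ρ * b        ≡⟨ lhs ρ degreeSum b ⟩
        ρ * (degreeSum + 4 + 2 * b)            ≤⟨ *-monoʳ-≤ ρ (euler′ f≤ m≤ (unbounded-count surjective region)) ⟩
        ρ * (2 * order + 2 * k)                ≡⟨ mid ρ order k ⟩
        2 * ρ * order + 2 * (ρ * k)
          ≤⟨ +-monoʳ-≤ (2 * ρ * order) (*-monoʳ-≤ 2 (boundary-count surjective region ρ ρ-spread)) ⟩
        2 * ρ * order + 2 * (degreeSum + ρ * b) ≡⟨ rhs ρ order degreeSum b ⟩
        2 * ρ * order + 2 * degreeSum + 2 * ρ * b ∎)
      where
      open ≤-Reasoning
      b = unbounded surjective region
      lhs : ∀ ρ D b → ρ * (D + 4) + 2 * ρ * b ≡ ρ * (D + 4 + 2 * b)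
      lhs = solve-∀
      mid : ∀ ρ s k → ρ * (2 * s + 2 * k) ≡ 2 * ρ * s + 2 * (ρ * k)
      mid = solve-∀
      rhs : ∀ ρ s D b → 2 * ρ * s + 2 * (D + ρ * b) ≡ 2 * ρ * s + 2 * D + 2 * ρ * b
      rhs = solve-∀

-- Double stars and degrees

lookup-injective : ∀ {a} {A : Set a} {xs : List A} → Unique xs → ∀ {i j} → lookup xs i ≡ lookup xs j → i ≡ j
lookup-injective (_ ∷ _)      {zero}  {zero}  _  = refl
lookup-injective (x∉ ∷ _)     {zero}  {suc j} eq = contradiction eq (All.lookup x∉ (∈-lookup j))
lookup-injective (x∉ ∷ _)     {suc i} {zero}  eq = contradiction (sym eq) (All.lookup x∉ (∈-lookup i))
lookup-injective (_ ∷ unique) {suc i} {suc j} eq = cong suc (lookup-injective unique eq)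

↑ˡ≢↑ʳ : ∀ {m n} (i : Fin m) (j : Fin n) → i ↑ˡ n ≢ m ↑ʳ j
↑ˡ≢↑ʳ zero    j ()
↑ˡ≢↑ʳ (suc i) j eq = ↑ˡ≢↑ʳ i j (Fin.suc-injective eq)

-- One injection carries all the leaves, so that its injectivity also makes the two leaf sets
-- disjoint.
doubleStar-embedding : ∀ {V : Set} (G : Graph V) {m k} → let open Graph G in
  ∀ {u v} → Adj u v → (leaf : Fin (m + k) → V) → Injective _≡_ _≡_ leaf →
  (∀ i → leaf i ≢ u) → (∀ i → leaf i ≢ v) → (∀ i → Adj u (leaf (i ↑ˡ k))) → (∀ j → Adj v (leaf (m ↑ʳ j))) →
  Contains G (doubleStar m k)
doubleStar-embedding {V} G {m} {k} {u} {v} uv leaf leaf-injective ≢u ≢v u~ v~ = f , f-injective , f-adjacent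
  where
  open Graph G
  sym-adj : ∀ {x y} → Adj x y → Adj y x
  sym-adj = subst T (symmetric _ _)
  u≢v : u ≢ v
  u≢v refl = subst T (irreflexive u) uv
  f : DoubleStarVertex m k → V
  f xCentre   = u
  f yCentre   = v
  f (xLeaf i) = leaf (i ↑ˡ k)
  f (yLeaf j) = leaf (m ↑ʳ j)
  f-injective : Injective _≡_ _≡_ f
  f-injective {xCentre} {xCentre} _  = refl
  f-injective {xCentre} {yCentre} eq = contradiction eq u≢v
  f-injective {xCentre} {xLeaf _} eq = contradiction (sym eq) (≢u _)
  f-injective {xCentre} {yLeaf _} eq = contradiction (sym eq) (≢u _)
  f-injective {yCentre} {xCentre} eq = contradiction (sym eq) u≢v
  f-injective {yCentre} {yCentre} _  = refl
  f-injective {yCentre} {xLeaf _} eq = contradiction (sym eq) (≢v _)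
  f-injective {yCentre} {yLeaf _} eq = contradiction (sym eq) (≢v _)
  f-injective {xLeaf _} {xCentre} eq = contradiction eq (≢u _)
  f-injective {xLeaf _} {yCentre} eq = contradiction eq (≢v _)
  f-injective {xLeaf i} {xLeaf j} eq = cong xLeaf (Fin.↑ˡ-injective k i j (leaf-injective eq))
  f-injective {xLeaf i} {yLeaf j} eq = contradiction (leaf-injective eq) (↑ˡ≢↑ʳ i j)
  f-injective {yLeaf _} {xCentre} eq = contradiction eq (≢u _)
  f-injective {yLeaf _} {yCentre} eq = contradiction eq (≢v _)
  f-injective {yLeaf i} {xLeaf j} eq = contradiction (sym (leaf-injective eq)) (↑ˡ≢↑ʳ j i)
  f-injective {yLeaf i} {yLeaf j} eq = cong yLeaf (Fin.↑ʳ-injective m i j (leaf-injective eq))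
  f-adjacent : ∀ a b → Graph.Adj (doubleStar m k) a b → Adj (f a) (f b)
  f-adjacent xCentre   yCentre   _ = uv
  f-adjacent yCentre   xCentre   _ = sym-adj uv
  f-adjacent xCentre   (xLeaf i) _ = u~ i
  f-adjacent (xLeaf i) xCentre   _ = sym-adj (u~ i)
  f-adjacent yCentre   (yLeaf j) _ = v~ j
  f-adjacent (yLeaf j) yCentre   _ = sym-adj (v~ j)

-- The cut after `k` entries falls within `cs` or at one of its ends, and the entries of `cs`
-- satisfy both predicates.
prefix-suffix : ∀ {A : Set} {P Q : A → Set} k {as bs cs : List A} → length as ≤ k → k ≤ length as + length cs →
                All P as → All P cs → All Q cs → All Q bs →
                All P (take k (as ++ cs ++ bs)) × All Q (drop k (as ++ cs ++ bs))
prefix-suffix zero    {[]}              _       _       _         _         q  q′ = [] , All.++⁺ q q′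
prefix-suffix (suc k) {[]}     {cs = _ ∷ _} _       (s≤s k≤) _      (p ∷ ps)  (_ ∷ q) q′
  with ps , qs ← prefix-suffix k z≤n k≤ [] ps q q′ = p ∷ ps , qs
prefix-suffix (suc k) {_ ∷ _}           (s≤s a≤) (s≤s k≤) (p ∷ ps) ps′ q q′
  with ps , qs ← prefix-suffix k a≤ k≤ ps ps′ q q′ = p ∷ ps , qs

module Degrees {n : ℕ} (G : Graph (Fin n)) where
  open Graph G

  degree : Fin n → ℕ
  degree v = ∑[ w < n ] [ T? (adj v w) ]

  codegree : Fin n → Fin n → ℕ
  codegree u v = ∑[ w < n ] [ T? (adj u w) ×-dec T? (adj v w) ]

  -- `v` is a neighbour of `u` but not of itself.
  codegree<degree : ∀ {u v} → Adj u v → codegree u v < degree u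
  codegree<degree {u} {v} uv = begin
    1 + codegree u v
      ≤⟨ +-monoˡ-≤ (codegree u v) (≤-trans (≤-reflexive (sym ([]-yes (v Fin.≟ v) refl)))
                                           (term≤sum (λ w → [ w Fin.≟ v ]) v)) ⟩
    ∑[ w < n ] [ w Fin.≟ v ] + codegree u v
      ≡⟨ ∑-distrib-+ (λ w → [ w Fin.≟ v ]) (λ w → [ T? (adj u w) ×-dec T? (adj v w) ]) ⟨
    ∑[ w < n ] ([ w Fin.≟ v ] + [ T? (adj u w) ×-dec T? (adj v w) ])
      ≤⟨ sum-mono (λ w → []-disjoint (w Fin.≟ v) (T? (adj u w) ×-dec T? (adj v w)) (T? (adj u w))
           (λ { refl → uv }) proj₁ λ { refl (_ , vv) → subst T (irreflexive v) vv }) ⟩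
    degree u ∎
    where open ≤-Reasoning

  private-neighbours : ∀ u v → List (Fin n)
  private-neighbours u v = filter (λ w → T? (adj u w) ×-dec ¬? (T? (adj v w)) ×-dec ¬? (w Fin.≟ v)) (allFin n)

  common-neighbours : ∀ u v → List (Fin n)
  common-neighbours u v = filter (λ w → T? (adj u w) ×-dec T? (adj v w)) (allFin n)

  degree≤ : ∀ u v → degree u ≤ length (private-neighbours u v) + codegree u v + 1
  degree≤ u v = begin
    degree u
      ≤⟨ sum-mono split ⟩
    ∑[ w < n ] (p w + c w + [ w Fin.≟ v ])
      ≡⟨ trans (∑-distrib-+ (λ w → p w + c w) (λ w → [ w Fin.≟ v ]))
               (cong (_+ ∑[ w < n ] [ w Fin.≟ v ]) (∑-distrib-+ p c)) ⟩
    sum p + codegree u v + ∑[ w < n ] [ w Fin.≟ v ]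
      ≤⟨ +-mono-≤ (≤-reflexive (cong (_+ codegree u v) (sym (length-filter-tabulate private? id))))
                  (count-unique (Fin._≟ v) λ i≡ j≡ → trans i≡ (sym j≡)) ⟩
    length (private-neighbours u v) + codegree u v + 1 ∎
    where
    open ≤-Reasoning
    private? : Decidable (λ w → Adj u w × ¬ Adj v w × w ≢ v)
    private? w = T? (adj u w) ×-dec ¬? (T? (adj v w)) ×-dec ¬? (w Fin.≟ v)
    p c : Fin n → ℕ
    p w = [ private? w ]
    c w = [ T? (adj u w) ×-dec T? (adj v w) ]
    split : ∀ w → [ T? (adj u w) ] ≤ p w + c w + [ w Fin.≟ v ]
    split w with T? (adj u w) | T? (adj v w) | w Fin.≟ v
    ... | no _  | _     | _     = z≤n
    ... | yes _ | _     | yes _ = m≤n+m 1 _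
    ... | yes _ | yes _ | no _  = ≤-refl
    ... | yes _ | no _  | no _  = ≤-refl

  -- With the private neighbours of u first, the common ones next and the private ones of v last, three
  -- leaves are taken from the front for u and the next four for v.
  star-free⇒degrees : ¬ Contains G (doubleStar 3 4) → ∀ {u v} → Adj u v → 4 ≤ degree u → 5 ≤ degree v →
                      degree u + degree v ≤ 8 + codegree u v
  star-free⇒degrees free {u} {v} uv 4≤u 5≤v = ≮⇒≥ λ large → free (star large)
    where
    A B C U : List (Fin n)
    A = private-neighbours u v
    B = private-neighbours v u
    C = common-neighbours u v
    -- Private neighbours of `u` beyond the third are dropped, since they would end up among the
    -- leaves of `v`.
    U = take 3 A ++ C ++ B
    γ = codegree u v
    C-length : length C ≡ γ
    C-length = length-filter-tabulate (λ w → T? (adj u w) ×-dec T? (adj v w)) id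
    codegree-sym : codegree v u ≡ γ
    codegree-sym = sum-cong-≗ λ w → []-cong (T? (adj v w) ×-dec T? (adj u w)) (T? (adj u w) ×-dec T? (adj v w))
                     (λ (a , b) → b , a) (λ (a , b) → b , a)
    A-large : degree u ≤ length A + γ + 1
    A-large = degree≤ u v
    B-large : degree v ≤ length B + γ + 1
    B-large = subst (λ g → degree v ≤ length B + g + 1) codegree-sym (degree≤ v u)
    inA : All (λ w → Adj u w × ¬ Adj v w × w ≢ v) (take 3 A)
    inA = All.take⁺ 3 (All.all-filter (λ w → T? (adj u w) ×-dec ¬? (T? (adj v w)) ×-dec ¬? (w Fin.≟ v)) (allFin n))
    inB : All (λ w → Adj v w × ¬ Adj u w × w ≢ u) B
    inB = All.all-filter (λ w → T? (adj v w) ×-dec ¬? (T? (adj u w)) ×-dec ¬? (w Fin.≟ u)) (allFin n)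
    inC : All (λ w → Adj u w × Adj v w) C
    inC = All.all-filter (λ w → T? (adj u w) ×-dec T? (adj v w)) (allFin n)
    no-loop : ∀ {w x} → Adj x w → w ≢ x
    no-loop {w} xw refl = subst T (irreflexive w) xw
    U≢u : All (_≢ u) U
    U≢u = All.++⁺ (All.map (no-loop ∘ proj₁) inA) (All.++⁺ (All.map (no-loop ∘ proj₁) inC) (All.map (proj₂ ∘ proj₂) inB))
    U≢v : All (_≢ v) U
    U≢v = All.++⁺ (All.map (proj₂ ∘ proj₂) inA) (All.++⁺ (All.map (no-loop ∘ proj₂) inC) (All.map (no-loop ∘ proj₁) inB))
    U-unique : Unique U
    U-unique = Unique.++⁺ (Unique.take⁺ 3 (Unique.filter⁺ _ (Unique.allFin⁺ n)))
      (Unique.++⁺ (Unique.filter⁺ _ (Unique.allFin⁺ n)) (Unique.filter⁺ _ (Unique.allFin⁺ n))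
        λ (w∈C , w∈B) → proj₁ (proj₂ (All.lookup inB w∈B)) (proj₁ (All.lookup inC w∈C)))
      λ (w∈A , w∈CB) → proj₁ (proj₂ (All.lookup inA w∈A))
        (All.lookup (All.++⁺ (All.map proj₂ inC) (All.map proj₁ inB)) w∈CB)
    -- Of the at least four neighbours of `u`, only one is lost to the centre `v`.
    3≤ : 3 ≤ 3 ⊓ length A + γ
    3≤ with ≤-total 3 (length A)
    ... | inj₁ 3≤A rewrite m≤n⇒m⊓n≡m 3≤A = m≤m+n 3 γ
    ... | inj₂ A≤3 rewrite m≥n⇒m⊓n≡n A≤3 = +-cancelʳ-≤ 1 3 _ (≤-trans 4≤u A-large)
    -- If `A` fills the three places of `u`, the at least four neighbours of `v` other than `u` fill
    -- the rest. Otherwise all of `A` is kept, and the large degree sum supplies seven leaves in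
    -- total.
    7≤ : 9 + γ ≤ degree u + degree v → 7 ≤ 3 ⊓ length A + (γ + length B)
    7≤ large with ≤-total 3 (length A)
    ... | inj₁ 3≤A rewrite m≤n⇒m⊓n≡m 3≤A =
      +-monoʳ-≤ 3 (+-cancelʳ-≤ 1 4 _ (≤-trans 5≤v (≤-trans B-large (≤-reflexive (cong (_+ 1) (+-comm (length B) γ))))))
    ... | inj₂ A≤3 rewrite m≥n⇒m⊓n≡n A≤3 =
      +-cancelʳ-≤ (2 + γ) 7 _ (≤-trans (≤-trans large (+-mono-≤ A-large B-large)) (≤-reflexive (shuffle (length A) (length B) γ)))
      where
      shuffle : ∀ a b c → a + c + 1 + (b + c + 1) ≡ a + (c + b) + (2 + c)
      shuffle = solve-∀
    sides : All (Adj u) (take 3 U) × All (Adj v) (drop 3 U)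
    sides = prefix-suffix 3 (≤-trans (≤-reflexive (length-take 3 A)) (m⊓n≤m 3 _))
      (≤-trans 3≤ (≤-reflexive (cong₂ _+_ (sym (length-take 3 A)) (sym C-length))))
      (All.map proj₁ inA) (All.map proj₁ inC) (All.map proj₂ inC) (All.map proj₁ inB)
    fromList : ∀ W → 7 ≤ length W → Unique W → All (_≢ u) W → All (_≢ v) W →
               All (Adj u) (take 3 W) → All (Adj v) (drop 3 W) → Contains G (doubleStar 3 4)
    fromList W@(_ ∷ _ ∷ _ ∷ _ ∷ _ ∷ _ ∷ _ ∷ rest) _ unique ≢u ≢v (u₀ ∷ u₁ ∷ u₂ ∷ []) (v₀ ∷ v₁ ∷ v₂ ∷ v₃ ∷ _) =
      doubleStar-embedding G {3} {4} uv (lookup W ∘ (_↑ˡ length rest))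
        (λ {i} {j} eq → Fin.↑ˡ-injective (length rest) i j (lookup-injective unique eq))
        (λ i → All.lookup ≢u (∈-lookup (i ↑ˡ length rest))) (λ i → All.lookup ≢v (∈-lookup (i ↑ˡ length rest)))
        (λ { zero → u₀ ; (suc zero) → u₁ ; (suc (suc zero)) → u₂ })
        (λ { zero → v₀ ; (suc zero) → v₁ ; (suc (suc zero)) → v₂ ; (suc (suc (suc zero))) → v₃ })
    fromList (_ ∷ []) (s≤s ())
    fromList (_ ∷ _ ∷ []) (s≤s (s≤s ()))
    fromList (_ ∷ _ ∷ _ ∷ []) (s≤s (s≤s (s≤s ())))
    fromList (_ ∷ _ ∷ _ ∷ _ ∷ []) (s≤s (s≤s (s≤s (s≤s ()))))
    fromList (_ ∷ _ ∷ _ ∷ _ ∷ _ ∷ []) (s≤s (s≤s (s≤s (s≤s (s≤s ())))))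
    fromList (_ ∷ _ ∷ _ ∷ _ ∷ _ ∷ _ ∷ []) (s≤s (s≤s (s≤s (s≤s (s≤s (s≤s ()))))))
    star : 9 + γ ≤ degree u + degree v → Contains G (doubleStar 3 4)
    star large = fromList U (≤-trans (7≤ large) (≤-reflexive (sym (trans (length-++ (take 3 A))
        (cong₂ _+_ (length-take 3 A) (trans (length-++ C) (cong (_+ length B) C-length)))))))
      U-unique U≢u U≢v (proj₁ sides) (proj₂ sides)

-- Lengths of boundary walks

module Spread {n : ℕ} {G : Graph (Fin n)} (planar : Planar G) {S : Fin n → Set} (S? : Decidable S) where
  open Graph G
  open Planar planar
  open Rotation rotationSystem
  open Euler planar S?

  Continues : Fin n → Fin n → Set
  Continues u v = ∃[ w ] Adj v w × S w × w ≢ u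

  NoIsolatedEdge : Set
  NoIsolatedEdge = ∀ {u v} → Adj u v → S u → S v → Continues u v ⊎ Continues v u

  module _ (noIsolatedEdge : NoIsolatedEdge)
           {k} {ℓ : Dart G → Fin k} (region : Regions {S} ℓ) (d₀ : Dart G) (d₀-inner : Inner {S} d₀) where

    private
      source≢target : ∀ (d : Dart G) → source d ≢ target d
      source≢target (dart u .u uu) refl = subst T (irreflexive u) uu

    record Walk (d : Dart G) : Set where
      field
        after         : Dart G
        after-source  : source after ≡ target d
        after-inner   : Inner {S} after
        after-region  : ℓ after ≡ ℓ d
        no-backtrack  : Continues (source d) (target d) → target after ≢ source d

      d≢after : d ≢ after
      d≢after eq = source≢target d (trans (cong source eq) after-source)

    open Walk

    walk : ∀ d → Inner {S} d → Walk d
    walk d inner with e , s , e-inner , ℓe , forward ← Successor.successor S? region d inner = record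
      { after = e ; after-source = s ; after-inner = e-inner ; after-region = ℓe
      ; no-backtrack = λ (w , vw , w∈S , w≢) → forward w vw w∈S w≢ }

    -- Returning to `d` after two steps means backtracking at both of its ends, which happens only
    -- on an isolated edge.
    second≢ : ∀ {d} → Inner {S} d → (w₁ : Walk d) (w₂ : Walk (after w₁)) → d ≢ after w₂
    second≢ {d} (u∈S , v∈S) w₁ w₂ eq with noIsolatedEdge (adjacent d) u∈S v∈S
    ... | inj₁ continues = no-backtrack w₁ continues (trans (sym (after-source w₂)) (cong source (sym eq)))
    ... | inj₂ continues = no-backtrack w₂
      (subst₂ Continues (sym (after-source w₁)) (trans (cong source eq) (after-source w₂)) continues)
      (trans (cong target (sym eq)) (sym (after-source w₁)))

    private
      w₁ = walk d₀ d₀-inner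
      d₁ = after w₁
      w₂ = walk d₁ (after-inner w₁)
      d₂ = after w₂
      w₃ = walk d₂ (after-inner w₂)
      d₃ = after w₃
      ℓ₁ = after-region w₁
      ℓ₂ = trans (after-region w₂) ℓ₁
      ℓ₃ = trans (after-region w₃) ℓ₂

    spread₃ : ∃[ ds ] Unique ds × length ds ≡ 3 × All (λ e → Inner {S} e × ℓ e ≡ ℓ d₀) ds
    spread₃ = d₀ ∷ d₁ ∷ d₂ ∷ [] ,
      (d≢after w₁ ∷ second≢ d₀-inner w₁ w₂ ∷ []) ∷ (d≢after w₂ ∷ []) ∷ [] ∷ [] , refl ,
      (d₀-inner , refl) ∷ (after-inner w₁ , ℓ₁) ∷ (after-inner w₂ , ℓ₂) ∷ []

    -- Returning to `d₀` after three steps would close a triangle.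
    spread₄ : (∀ {u v w} → S u → S v → S w → Adj u v → Adj v w → ¬ Adj w u) →
              ∃[ ds ] Unique ds × length ds ≡ 4 × All (λ e → Inner {S} e × ℓ e ≡ ℓ d₀) ds
    spread₄ triangle-free = d₀ ∷ d₁ ∷ d₂ ∷ d₃ ∷ [] ,
      (d≢after w₁ ∷ second≢ d₀-inner w₁ w₂ ∷ third≢ ∷ []) ∷
      (d≢after w₂ ∷ second≢ (after-inner w₁) w₂ w₃ ∷ []) ∷ (d≢after w₃ ∷ []) ∷ [] ∷ [] , refl ,
      (d₀-inner , refl) ∷ (after-inner w₁ , ℓ₁) ∷ (after-inner w₂ , ℓ₂) ∷ (after-inner w₃ , ℓ₃) ∷ []
      where
      third≢ : d₀ ≢ d₃
      third≢ eq = triangle-free (proj₁ d₀-inner) (proj₂ d₀-inner) (proj₂ (after-inner w₁))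
        (adjacent d₀) (subst (λ v → Adj v (target d₁)) (after-source w₁) (adjacent d₁))
        (subst₂ Adj (after-source w₂) (trans (sym (after-source w₃)) (cong source (sym eq))) (adjacent d₂))

-- Degree conditions in star-free planar graphs

module StarFree {n : ℕ} {G : Graph (Fin n)} (planar : Planar G) (free : ¬ Contains G (doubleStar 3 4)) where
  open Graph G
  open Degrees G

  adj-sym : ∀ {u v} → Adj u v → Adj v u
  adj-sym = subst T (symmetric _ _)

  adj-irrefl : ∀ {u v} → Adj u v → u ≢ v
  adj-irrefl {u} uu refl = subst T (irreflexive u) uu

  another-neighbour : ∀ v → 2 ≤ degree v → ∀ u → ∃[ w ] Adj v w × w ≢ u
  another-neighbour v 2≤ u with Fin.any? (λ w → T? (adj v w) ×-dec ¬? (w Fin.≟ u))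
  ... | yes found = found
  ... | no none = contradiction
    (≤-trans 2≤ (count-unique (λ w → T? (adj v w)) λ {i} {j} vi vj → trans (only i vi) (sym (only j vj))))
    λ { (s≤s ()) }
    where
    only : ∀ w → Adj v w → w ≡ u
    only w vw with w Fin.≟ u
    ... | yes w≡u = w≡u
    ... | no w≢u  = contradiction (w , vw , w≢u) none

  high⇒low-neighbours : ∀ {u v} → Adj u v → 8 ≤ degree v → degree u ≤ 3
  high⇒low-neighbours {u} {v} uv 8≤v = ≮⇒≥ λ 4≤u → <-irrefl refl (begin-strict
    degree u + degree v ≤⟨ star-free⇒degrees free uv 4≤u (≤-trans (m≤n+m 5 3) 8≤v) ⟩
    8 + codegree u v    <⟨ +-monoʳ-< 8 (codegree<degree uv) ⟩
    8 + degree u        ≤⟨ +-monoˡ-≤ (degree u) 8≤v ⟩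
    degree v + degree u ≡⟨ +-comm (degree v) (degree u) ⟩
    degree u + degree v ∎)
    where open ≤-Reasoning

  module Neighbourhood (v : Fin n) (2≤v : 2 ≤ degree v) where

    Near : Fin n → Set
    Near w = w ≡ v ⊎ Adj v w

    near? : Decidable Near
    near? w = w Fin.≟ v ⊎-dec T? (adj v w)

    open Euler planar near?
    open Spread planar near?

    order≤ : order ≤ 1 + degree v
    order≤ = begin
      order                                              ≤⟨ sum-mono split ⟩
      ∑[ w < n ] ([ w Fin.≟ v ] + [ T? (adj v w) ])      ≡⟨ ∑-distrib-+ (λ w → [ w Fin.≟ v ]) (λ w → [ T? (adj v w) ]) ⟩
      ∑[ w < n ] [ w Fin.≟ v ] + degree v                ≤⟨ +-monoˡ-≤ (degree v) at-v ⟩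
      1 + degree v                                       ∎
      where
      open ≤-Reasoning
      at-v : ∑[ w < n ] [ w Fin.≟ v ] ≤ 1
      at-v = count-unique (Fin._≟ v) λ i≡ j≡ → trans i≡ (sym j≡)
      split : ∀ w → [ near? w ] ≤ [ w Fin.≟ v ] + [ T? (adj v w) ]
      split w with w Fin.≟ v | T? (adj v w)
      ... | yes _ | _     = s≤s z≤n
      ... | no _  | yes _ = ≤-refl
      ... | no _  | no _  = ≤-refl

    codegreeSum : ℕ
    codegreeSum = ∑[ w < n ] ([ T? (adj v w) ] * codegree w v)

    -- The spokes count in both orientations; an edge between two neighbours of `v` is counted by
    -- `codegreeSum` from each of its ends.
    ≤degreeSum : 2 * degree v + codegreeSum ≤ degreeSum
    ≤degreeSum = begin
      2 * degree v + codegreeSum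
        ≡⟨ cong₂ _+_ (cong₂ _+_ (trans spokes (∑-comm λ y x → [ spoke? y x ])) (trans (+-identityʳ (degree v)) spokes))
                     (sum-cong-≗ λ x → count-× (T? (adj v x)) (λ y → T? (adj x y) ×-dec T? (adj v y))) ⟩
      ΣΣ (λ x y → [ spoke? y x ]) + ΣΣ (λ x y → [ spoke? x y ]) + ΣΣ (λ x y → [ rim? x y ])
        ≡⟨ cong (_+ ΣΣ (λ x y → [ rim? x y ])) (∑∑-distrib-+ (λ x y → [ spoke? y x ]) (λ x y → [ spoke? x y ])) ⟨
      ΣΣ (λ x y → [ spoke? y x ] + [ spoke? x y ]) + ΣΣ (λ x y → [ rim? x y ])
        ≡⟨ ∑∑-distrib-+ (λ x y → [ spoke? y x ] + [ spoke? x y ]) (λ x y → [ rim? x y ]) ⟨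
      ΣΣ (λ x y → [ spoke? y x ] + [ spoke? x y ] + [ rim? x y ])
        ≤⟨ sum-mono (λ x → sum-mono (split x)) ⟩
      degreeSum ∎
      where
      open ≤-Reasoning
      ΣΣ : (Fin n → Fin n → ℕ) → ℕ
      ΣΣ h = ∑[ x < n ] ∑[ y < n ] h x y
      spoke? : ∀ x y → Dec (Adj v x × v ≡ y)
      spoke? x y = T? (adj v x) ×-dec v Fin.≟ y
      rim? : ∀ x y → Dec (Adj v x × Adj x y × Adj v y)
      rim? x y = T? (adj v x) ×-dec T? (adj x y) ×-dec T? (adj v y)
      spokes : degree v ≡ ΣΣ (λ x y → [ spoke? x y ])
      spokes = sym (sum-cong-≗ λ x → count-fibre (T? (adj v x)) v)
      split : ∀ x y → [ spoke? y x ] + [ spoke? x y ] + [ rim? x y ] ≤ [ inner? x y ]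
      split x y = ≤-trans
        (+-monoˡ-≤ [ rim? x y ] ([]-disjoint (spoke? y x) (spoke? x y) (spoke? y x ⊎-dec spoke? x y) inj₁ inj₂
           λ { (_ , refl) (vv , _) → adj-irrefl vv refl }))
        ([]-disjoint (spoke? y x ⊎-dec spoke? x y) (rim? x y) (inner? x y)
           (λ { (inj₁ (vy , refl)) → vy , inj₁ refl , inj₂ vy ; (inj₂ (vx , refl)) → adj-sym vx , inj₂ vx , inj₁ refl })
           (λ (vx , xy , vy) → xy , inj₂ vx , inj₂ vy)
           (λ { (inj₁ (_ , refl)) (vv , _) → adj-irrefl vv refl ; (inj₂ (_ , refl)) (_ , _ , vv) → adj-irrefl vv refl }))

    -- An edge at `v` continues along another spoke, and an edge between neighbours of `v` continues
    -- to `v`.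
    noIsolatedEdge : NoIsolatedEdge
    noIsolatedEdge {a} {b} ab (inj₁ refl) _ with w , aw , w≢b ← another-neighbour a 2≤v b =
      inj₂ (w , aw , inj₂ aw , w≢b)
    noIsolatedEdge {a} {b} ab (inj₂ va) (inj₁ refl) with w , bw , w≢a ← another-neighbour b 2≤v a =
      inj₁ (w , bw , inj₂ bw , w≢a)
    noIsolatedEdge {a} {b} ab (inj₂ va) (inj₂ vb) = inj₁ (v , adj-sym vb , inj₁ refl , adj-irrefl va)

    -- The bound e ≤ 3s - 6 on at most `1 + degree v` vertices, doubled, minus the spokes. This is
    -- the outerplanar bound 2d - 3 on the edges among the d neighbours of `v`.
    codegreeSum≤ : codegreeSum + 6 ≤ 4 * degree v
    codegreeSum≤ with w , vw , _ ← another-neighbour v 2≤v v = +-cancelʳ-≤ (2 * degree v + 2 * degreeSum + 6) _ _ (begin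
      codegreeSum + 6 + (2 * degree v + 2 * degreeSum + 6) ≡⟨ lhs (degree v) codegreeSum degreeSum ⟩
      2 * degree v + codegreeSum + 12 + 2 * degreeSum    ≤⟨ +-monoˡ-≤ (2 * degreeSum) (+-monoˡ-≤ 12 ≤degreeSum) ⟩
      degreeSum + 12 + 2 * degreeSum                     ≡⟨ mid degreeSum ⟩
      3 * (degreeSum + 4)
        ≤⟨ euler-bound (dart v w vw) (inj₁ refl , inj₂ vw) 3 (spread₃ noIsolatedEdge) ⟩
      6 * order + 2 * degreeSum                          ≤⟨ +-monoˡ-≤ (2 * degreeSum) (*-monoʳ-≤ 6 order≤) ⟩
      6 * (1 + degree v) + 2 * degreeSum                 ≡⟨ rhs (degree v) degreeSum ⟩
      4 * degree v + (2 * degree v + 2 * degreeSum + 6) ∎)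
      where
      open ≤-Reasoning
      lhs : ∀ d c D → c + 6 + (2 * d + 2 * D + 6) ≡ 2 * d + c + 12 + 2 * D
      lhs = solve-∀
      mid : ∀ D → D + 12 + 2 * D ≡ 3 * (D + 4)
      mid = solve-∀
      rhs : ∀ d D → 6 * (1 + d) + 2 * D ≡ 4 * d + (2 * d + 2 * D + 6)
      rhs = solve-∀

  High : Fin n → Set
  High v = 8 ≤ degree v

  -- The vertices that the discharging leaves short: starting from 40 - 7 * 3 = 19, they send 7 to
  -- each of three neighbours and lack 2.
  Surrounded : Fin n → Set
  Surrounded v = degree v ≡ 3 × (∀ w → Adj v w → High w)

  high? : Decidable High
  high? v = 8 ≤? degree v

  surrounded? : Decidable Surrounded
  surrounded? v = degree v ≟ 3 ×-dec Fin.all? (λ w → T? (adj v w) →-dec high? w)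

  highs surroundeds : ℕ
  highs       = ∑[ v < n ] [ high? v ]
  surroundeds = ∑[ v < n ] [ surrounded? v ]

  low⇒¬high : ∀ {v} → degree v ≤ 3 → ¬ High v
  low⇒¬high ≤3 8≤ = contradiction (≤-trans 8≤ ≤3) λ { (s≤s (s≤s (s≤s ()))) }

  surrounded⇒¬high : ∀ {v} → Surrounded v → ¬ High v
  surrounded⇒¬high (≡3 , _) = low⇒¬high (≤-reflexive ≡3)

  module HighSurrounded where

    Either : Fin n → Set
    Either v = High v ⊎ Surrounded v

    either? : Decidable Either
    either? v = high? v ⊎-dec surrounded? v

    open Euler planar either?
    open Spread planar either?

    order≤ : order ≤ highs + surroundeds
    order≤ = ≤-trans (sum-mono split) (≤-reflexive (∑-distrib-+ (λ v → [ high? v ]) (λ v → [ surrounded? v ])))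
      where
      split : ∀ w → [ either? w ] ≤ [ high? w ] + [ surrounded? w ]
      split w with high? w | surrounded? w
      ... | yes _ | _     = s≤s z≤n
      ... | no _  | yes _ = ≤-refl
      ... | no _  | no _  = ≤-refl

    -- All three edges of a surrounded vertex lead to high vertices, hence stay in the set and never
    -- join two surrounded vertices; each counts in both orientations.
    ≤degreeSum : 6 * surroundeds ≤ degreeSum
    ≤degreeSum = begin
      6 * surroundeds
        ≡⟨ *-distribʳ-+ surroundeds 3 3 ⟩
      3 * surroundeds + 3 * surroundeds
        ≡⟨ cong₂ _+_ rows (trans rows (∑-comm λ x y → [ edge? x y ])) ⟩
      ∑[ x < n ] ∑[ y < n ] [ edge? x y ] + ∑[ x < n ] ∑[ y < n ] [ edge? y x ]
        ≡⟨ ∑∑-distrib-+ (λ x y → [ edge? x y ]) (λ x y → [ edge? y x ]) ⟨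
      ∑[ x < n ] ∑[ y < n ] ([ edge? x y ] + [ edge? y x ])
        ≤⟨ sum-mono (λ x → sum-mono λ y → []-disjoint (edge? x y) (edge? y x) (inner? x y)
             (λ (s , xy) → xy , inj₂ s , inj₁ (proj₂ s y xy))
             (λ (s , yx) → adj-sym yx , inj₁ (proj₂ s x yx) , inj₂ s)
             (λ (s , xy) (s′ , _) → surrounded⇒¬high s′ (proj₂ s y xy))) ⟩
      degreeSum ∎
      where
      open ≤-Reasoning
      edge? : ∀ x y → Dec (Surrounded x × Adj x y)
      edge? x y = surrounded? x ×-dec T? (adj x y)
      rows : 3 * surroundeds ≡ ∑[ x < n ] ∑[ y < n ] [ edge? x y ]
      rows = trans (*-distribˡ-sum 3 (λ x → [ surrounded? x ])) (sum-cong-≗ λ x →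
               trans (row x) (count-× (surrounded? x) (λ y → T? (adj x y))))
        where
        row : ∀ x → 3 * [ surrounded? x ] ≡ [ surrounded? x ] * degree x
        row x with surrounded? x
        ... | no _          = refl
        ... | yes (d≡3 , _) = sym (trans (+-identityʳ (degree x)) d≡3)

    -- Two high vertices are never adjacent, since the neighbours of a high vertex have degree at
    -- most 3.
    opposite-sides : ∀ {u v} → Either u → Either v → Adj u v → (High u × Surrounded v) ⊎ (Surrounded u × High v)
    opposite-sides (inj₂ s) _        uv = inj₂ (s , proj₂ s _ uv)
    opposite-sides (inj₁ h) (inj₂ s) uv = inj₁ (h , s)
    opposite-sides (inj₁ h) (inj₁ h′) uv = contradiction h (low⇒¬high (high⇒low-neighbours uv h′))

    triangle-free : ∀ {u v w} → Either u → Either v → Either w → Adj u v → Adj v w → ¬ Adj w u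
    triangle-free u∈ v∈ w∈ uv vw wu with opposite-sides u∈ v∈ uv | opposite-sides v∈ w∈ vw | opposite-sides w∈ u∈ wu
    ... | inj₁ (_ , s) | inj₁ (h , _) | _            = surrounded⇒¬high s h
    ... | inj₁ (h , _) | inj₂ _       | inj₁ (_ , s) = surrounded⇒¬high s h
    ... | inj₁ _       | inj₂ (_ , h) | inj₂ (s , _) = surrounded⇒¬high s h
    ... | inj₂ (_ , h) | inj₂ (s , _) | _            = surrounded⇒¬high s h
    ... | inj₂ _       | inj₁ (_ , s) | inj₁ (h , _) = surrounded⇒¬high s h
    ... | inj₂ (s , _) | inj₁ _       | inj₂ (_ , h) = surrounded⇒¬high s h

    continue : ∀ {u v} → Surrounded v → Continues u v
    continue {u} {v} s@(d≡3 , highs) with w , vw , w≢u ← another-neighbour v (subst (2 ≤_) (sym d≡3) (m≤n+m 2 1)) u =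
      w , vw , inj₁ (highs w vw) , w≢u

    noIsolatedEdge : NoIsolatedEdge
    noIsolatedEdge uv u∈ v∈ with opposite-sides u∈ v∈ uv
    ... | inj₁ (_ , s) = inj₁ (continue s)
    ... | inj₂ (s , _) = inj₂ (continue s)

    -- With l surrounded and h high vertices there are at least 3l edges, and at most 2(h + l) - 4
    -- because no region is a triangle.
    surroundeds≤ : surroundeds ≤ 2 * highs
    surroundeds≤ with Fin.any? surrounded?
    -- Euler's bound starts from an edge, which only a surrounded vertex is sure to provide.
    ... | no none = ≤-trans (≤-reflexive (sum-zero _ λ v → []-no (surrounded? v) λ s → none (v , s))) z≤n
    ... | yes (v , s@(d≡3 , all-high)) with w , vw , _ ← another-neighbour v (subst (2 ≤_) (sym d≡3) (m≤n+m 2 1)) v =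
      *-cancelˡ-≤ 4 (+-cancelʳ-≤ (8 * surroundeds + 16 + 2 * degreeSum) _ _ (begin
        4 * surroundeds + (8 * surroundeds + 16 + 2 * degreeSum) ≡⟨ lhs surroundeds degreeSum ⟩
        2 * (6 * surroundeds) + 16 + 2 * degreeSum ≤⟨ +-monoˡ-≤ (2 * degreeSum) (+-monoˡ-≤ 16 (*-monoʳ-≤ 2 ≤degreeSum)) ⟩
        2 * degreeSum + 16 + 2 * degreeSum         ≡⟨ mid degreeSum ⟩
        4 * (degreeSum + 4)
          ≤⟨ euler-bound (dart v w vw) (inj₂ s , inj₁ (all-high w vw)) 4
               (λ region d inner → spread₄ noIsolatedEdge region d inner triangle-free) ⟩
        8 * order + 2 * degreeSum                  ≤⟨ +-monoˡ-≤ (2 * degreeSum) (*-monoʳ-≤ 8 order≤) ⟩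
        8 * (highs + surroundeds) + 2 * degreeSum  ≤⟨ m≤m+n _ 16 ⟩
        8 * (highs + surroundeds) + 2 * degreeSum + 16 ≡⟨ rhs highs surroundeds degreeSum ⟩
        4 * (2 * highs) + (8 * surroundeds + 16 + 2 * degreeSum) ∎))
      where
      open ≤-Reasoning
      lhs : ∀ l D → 4 * l + (8 * l + 16 + 2 * D) ≡ 2 * (6 * l) + 16 + 2 * D
      lhs = solve-∀
      mid : ∀ D → 2 * D + 16 + 2 * D ≡ 4 * (D + 4)
      mid = solve-∀
      rhs : ∀ h l D → 8 * (h + l) + 2 * D + 16 ≡ 4 * (2 * h) + (8 * l + 16 + 2 * D)
      rhs = solve-∀

-- Discharging

-- Paid to each neighbour of degree 6 or 7. Degrees 4 and 5 can share out their whole surplus 40 -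
-- 7d, which is 12 and 5. The 5 for degrees up to 3 lets a degree-3 vertex with a neighbour of
-- degree below 8 manage on 19 = 7 + 7 + 5, and gives 7 ≤ 2 + 5 in `neighbour-gain`.
rate : ℕ → ℕ
rate 4 = 3
rate 5 = 1
rate d = 5 * [ d ≤? 3 ]

-- The charge, in sevenths, that a vertex of degree d sends to each neighbour of degree d′.
give : ℕ → ℕ → ℕ
give d d′ = 7 * [ d ≤? 3 ×-dec 8 ≤? d′ ] + rate d * [ 6 ≤? d′ ×-dec d′ ≤? 7 ]

data Size (d : ℕ) : Set where
  low   : d ≤ 3 → Size d
  four  : d ≡ 4 → Size d
  five  : d ≡ 5 → Size d
  large : 6 ≤ d → Size d

size : ∀ d → Size d
size 0 = low z≤n
size 1 = low (s≤s z≤n)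
size 2 = low (s≤s (s≤s z≤n))
size 3 = low ≤-refl
size 4 = four refl
size 5 = five refl
size (suc (suc (suc (suc (suc (suc d)))))) = large (m≤m+n 6 d)

rate-low : ∀ {d} → d ≤ 3 → rate d ≡ 5
rate-low z≤n                   = refl
rate-low (s≤s z≤n)             = refl
rate-low (s≤s (s≤s z≤n))       = refl
rate-low (s≤s (s≤s (s≤s z≤n))) = refl

rate-large : ∀ {d} → 6 ≤ d → rate d ≡ 0
rate-large (s≤s (s≤s (s≤s (s≤s (s≤s (s≤s _)))))) = refl

give-high : ∀ d d′ → d ≤ 3 → 8 ≤ d′ → give d d′ ≡ 7
give-high d d′ d≤3 8≤ = cong₂ (λ x y → 7 * x + y)
  ([]-yes (d ≤? 3 ×-dec 8 ≤? d′) (d≤3 , 8≤))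
  (trans (cong (rate d *_) ([]-no (6 ≤? d′ ×-dec d′ ≤? 7) λ (_ , ≤7) → <-irrefl refl (≤-trans 8≤ ≤7)))
         (*-zeroʳ (rate d)))

give-unhigh : ∀ d d′ → ¬ (d ≤ 3 × 8 ≤ d′) → give d d′ ≡ rate d * [ 6 ≤? d′ ×-dec d′ ≤? 7 ]
give-unhigh d d′ ¬high = cong (λ x → 7 * x + rate d * [ 6 ≤? d′ ×-dec d′ ≤? 7 ])
  ([]-no (d ≤? 3 ×-dec 8 ≤? d′) ¬high)

give≤rate : ∀ d d′ → ¬ (d ≤ 3 × 8 ≤ d′) → give d d′ ≤ rate d
give≤rate d d′ ¬high = ≤-trans (≤-reflexive (give-unhigh d d′ ¬high))
  (≤-trans (*-monoʳ-≤ (rate d) ([]≤1 (6 ≤? d′ ×-dec d′ ≤? 7))) (≤-reflexive (*-identityʳ (rate d))))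

give-middle : ∀ d d′ → 6 ≤ d′ → d′ ≤ 7 → give d d′ ≡ rate d
give-middle d d′ 6≤ ≤7 = trans (give-unhigh d d′ λ (_ , 8≤) → <-irrefl refl (≤-trans 8≤ ≤7))
  (trans (cong (rate d *_) ([]-yes (6 ≤? d′ ×-dec d′ ≤? 7) (6≤ , ≤7))) (*-identityʳ (rate d)))

give≤7 : ∀ d d′ → d ≤ 3 → give d d′ ≤ 7
give≤7 d d′ d≤3 with ≤-<-connex 8 d′
... | inj₁ 8≤ = ≤-reflexive (give-high d d′ d≤3 8≤)
... | inj₂ <8 = ≤-trans (give≤rate d d′ (<⇒≱ <8 ∘ proj₂)) (≤-trans (≤-reflexive (rate-low d≤3)) (m≤n+m 5 2))

module Balance {n : ℕ} {G : Graph (Fin n)} (planar : Planar G) (free : ¬ Contains G (doubleStar 3 4)) where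
  open Graph G
  open Degrees G
  open StarFree planar free

  ∑-adj-const : ∀ v k → ∑[ w < n ] ([ T? (adj v w) ] * k) ≡ degree v * k
  ∑-adj-const v k = sym (*-distribʳ-sum k (λ w → [ T? (adj v w) ]))

  ∑-adj-mono : ∀ v {f g : Fin n → ℕ} → (∀ w → Adj v w → f w ≤ g w) →
               ∑[ w < n ] ([ T? (adj v w) ] * f w) ≤ ∑[ w < n ] ([ T? (adj v w) ] * g w)
  ∑-adj-mono v {f} {g} f≤g = sum-mono pointwise
    where
    pointwise : ∀ w → [ T? (adj v w) ] * f w ≤ [ T? (adj v w) ] * g w
    pointwise w with T? (adj v w)
    ... | yes vw = *-monoʳ-≤ 1 (f≤g w vw)
    ... | no _   = z≤n

  out inn : Fin n → ℕ
  out v = ∑[ w < n ] ([ T? (adj v w) ] * give (degree v) (degree w))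
  inn v = ∑[ w < n ] ([ T? (adj v w) ] * give (degree w) (degree v))

  out≤ : ∀ v k → (∀ w → Adj v w → give (degree v) (degree w) ≤ k) → out v ≤ degree v * k
  out≤ v k bound = ≤-trans (∑-adj-mono v bound) (≤-reflexive (∑-adj-const v k))

  out-inn : ∑[ v < n ] out v ≡ ∑[ v < n ] inn v
  out-inn = trans (∑-comm (λ v w → [ T? (adj v w) ] * give (degree v) (degree w)))
    (sum-cong-≗ λ w → sum-cong-≗ λ v → cong (_* give (degree v) (degree w))
      ([]-cong (T? (adj v w)) (T? (adj w v)) adj-sym adj-sym))

  -- A neighbour that shares few neighbours with `v` has small degree and so pays more:
  -- `star-free⇒degrees` makes the codegree at least `degree v + degree w - 8`. Where it does not
  -- apply, for `degree w ≤ 3`, the payment alone reaches 7.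
  neighbour-gain : ∀ {v w} → 5 ≤ degree v → degree v ≤ 7 → Adj w v → degree v ≤ 2 + rate (degree w) + codegree w v
  neighbour-gain {v} {w} 5≤v v≤7 wv = gain (size (degree w))
    where
    open ≤-Reasoning
    gain : Size (degree w) → degree v ≤ 2 + rate (degree w) + codegree w v
    gain (low ≤3) = ≤-trans v≤7 (≤-trans (≤-reflexive (cong (2 +_) (sym (rate-low ≤3)))) (m≤m+n _ _))
    gain (four ≡4) = +-cancelˡ-≤ 3 _ _ (begin
      -- The payment 3 at degree 4 is one more than this inequality needs.
      3 + degree v        ≤⟨ n≤1+n _ ⟩
      4 + degree v        ≡⟨ cong (_+ degree v) (sym ≡4) ⟩
      degree w + degree v ≤⟨ star-free⇒degrees free wv (≤-reflexive (sym ≡4)) 5≤v ⟩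
      8 + codegree w v    ≡⟨ cong (λ d → 5 + rate d + codegree w v) (sym ≡4) ⟩
      5 + rate (degree w) + codegree w v ∎)
    gain (five ≡5) = +-cancelˡ-≤ 5 _ _ (begin
      5 + degree v        ≡⟨ cong (_+ degree v) (sym ≡5) ⟩
      degree w + degree v ≤⟨ star-free⇒degrees free wv (≤-trans (n≤1+n 4) (≤-reflexive (sym ≡5))) 5≤v ⟩
      8 + codegree w v    ≡⟨ cong (λ d → 7 + rate d + codegree w v) (sym ≡5) ⟩
      7 + rate (degree w) + codegree w v ∎)
    gain (large 6≤w) = +-cancelˡ-≤ 6 _ _ (begin
      6 + degree v        ≤⟨ +-monoˡ-≤ (degree v) 6≤w ⟩
      degree w + degree v ≤⟨ star-free⇒degrees free wv (≤-trans (m≤n+m 4 2) 6≤w) 5≤v ⟩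
      8 + codegree w v    ≤⟨ +-monoˡ-≤ (codegree w v) (m≤m+n 8 (rate (degree w))) ⟩
      8 + rate (degree w) + codegree w v ∎)

  -- `neighbour-gain` summed over all neighbours, with the codegrees bounded by `codegreeSum≤`: too
  -- dense a neighbourhood is not planar, so payments must make up the difference.
  middle-income : ∀ v → 6 ≤ degree v → degree v ≤ 7 → degree v * degree v + 6 ≤ inn v + 6 * degree v
  middle-income v 6≤v v≤7 = begin
    degree v * degree v + 6
      ≡⟨ cong (_+ 6) (sym (∑-adj-const v (degree v))) ⟩
    ∑[ w < n ] (a w * degree v) + 6
      ≤⟨ +-monoˡ-≤ 6 (∑-adj-mono v λ w vw → neighbour-gain (≤-trans (n≤1+n 5) 6≤v) v≤7 (adj-sym vw)) ⟩
    ∑[ w < n ] (a w * (2 + rate (degree w) + codegree w v)) + 6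
      ≡⟨ cong (_+ 6) (sum-cong-≗ λ w → trans (*-distribˡ-+ (a w) (2 + rate (degree w)) (codegree w v))
           (cong (_+ a w * codegree w v) (trans (*-distribˡ-+ (a w) 2 (rate (degree w)))
             (cong (λ r → a w * 2 + a w * r) (sym (give-middle (degree w) (degree v) 6≤v v≤7)))))) ⟩
    ∑[ w < n ] (a w * 2 + a w * give (degree w) (degree v) + a w * codegree w v) + 6
      ≡⟨ cong (_+ 6) (trans (∑-distrib-+ (λ w → a w * 2 + a w * give (degree w) (degree v)) (λ w → a w * codegree w v))
           (cong (_+ codegreeSum) (trans (∑-distrib-+ (λ w → a w * 2) (λ w → a w * give (degree w) (degree v)))
             (cong (_+ inn v) (∑-adj-const v 2))))) ⟩
    degree v * 2 + inn v + codegreeSum + 6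
      ≡⟨ +-assoc (degree v * 2 + inn v) codegreeSum 6 ⟩
    degree v * 2 + inn v + (codegreeSum + 6)
      ≤⟨ +-monoʳ-≤ (degree v * 2 + inn v) codegreeSum≤ ⟩
    degree v * 2 + inn v + 4 * degree v
      ≡⟨ collect (degree v) (inn v) ⟩
    inn v + 6 * degree v ∎
    where
    open ≤-Reasoning
    open Neighbourhood v (≤-trans (m≤n+m 2 4) 6≤v)
    a : Fin n → ℕ
    a w = [ T? (adj v w) ]
    collect : ∀ d i → d * 2 + i + 4 * d ≡ i + 6 * d
    collect = solve-∀

  -- In sevenths, a vertex starts with 40 - 7d. A high vertex must end with 40 to spare, and a
  -- surrounded one may lack 2.
  Balanced : Fin n → Set
  Balanced v = 7 * degree v + out v + 40 * [ high? v ] ≤ 40 + inn v + 2 * [ surrounded? v ]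

  balanced-unhigh : ∀ {v} → ¬ High v → 7 * degree v + out v ≤ 40 + inn v + 2 * [ surrounded? v ] → Balanced v
  balanced-unhigh {v} ¬high = ≤-trans (≤-reflexive
    (trans (cong (λ h → 7 * degree v + out v + 40 * h) ([]-no (high? v) ¬high)) (+-identityʳ _)))

  balanced-poor : ∀ {v} → ¬ High v → 7 * degree v + out v ≤ 40 → Balanced v
  balanced-poor {v} ¬high ≤40 = balanced-unhigh ¬high
    (≤-trans ≤40 (≤-trans (m≤m+n 40 (inn v)) (m≤m+n (40 + inn v) _)))

  large-out : ∀ {v} → 6 ≤ degree v → out v ≤ 0
  large-out {v} 6≤ = ≤-trans (out≤ v 0 λ w _ →
      ≤-trans (give≤rate (degree v) (degree w) λ (≤3 , _) → contradiction (≤-trans 6≤ ≤3) λ { (s≤s (s≤s (s≤s ()))) })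
              (≤-reflexive (rate-large 6≤)))
    (≤-reflexive (*-zeroʳ (degree v)))

  low-balanced : ∀ v → degree v ≤ 3 → Balanced v
  low-balanced v ≤3 with m≤n⇒m<n∨m≡n ≤3
  ... | inj₁ (s≤s ≤2) = balanced-poor (low⇒¬high ≤3) (begin
      7 * degree v + out v          ≤⟨ +-monoʳ-≤ (7 * degree v) (out≤ v 7 λ w _ → give≤7 (degree v) (degree w) ≤3) ⟩
      7 * degree v + degree v * 7   ≤⟨ +-mono-≤ (*-monoʳ-≤ 7 ≤2) (*-monoˡ-≤ 7 ≤2) ⟩
      28                            ≤⟨ m≤m+n 28 12 ⟩
      40                            ∎)
    where
    open ≤-Reasoning
  ... | inj₂ ≡3 with Fin.any? (λ w → T? (adj v w) ×-dec ¬? (high? w))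
  ...   | no none = balanced-unhigh (low⇒¬high ≤3) (begin
      7 * degree v + out v                      ≤⟨ +-monoʳ-≤ (7 * degree v) (out≤ v 7 λ w _ → give≤7 (degree v) (degree w) ≤3) ⟩
      7 * degree v + degree v * 7               ≡⟨ cong (λ d → 7 * d + d * 7) ≡3 ⟩
      42                                        ≤⟨ +-monoˡ-≤ 2 (m≤m+n 40 (inn v)) ⟩
      40 + inn v + 2                            ≡⟨ cong (λ s → 40 + inn v + 2 * s) ([]-yes (surrounded? v) (≡3 , all-high)) ⟨
      40 + inn v + 2 * [ surrounded? v ]        ∎)
    where
    open ≤-Reasoning
    all-high : ∀ w → Adj v w → High w
    all-high w vw with high? w
    ... | yes h = h
    ... | no ¬h = contradiction (w , vw , ¬h) none
  -- The neighbour `w₀` of degree below 8 gets at most 5 instead of 7; its doubled indicator records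
  -- this saving of 2 inside the sum.
  ...   | yes (w₀ , vw₀ , ¬high₀) = balanced-poor (low⇒¬high ≤3) (+-cancelʳ-≤ 2 _ _ (begin
      7 * degree v + out v + 2
        ≡⟨ +-assoc (7 * degree v) (out v) 2 ⟩
      7 * degree v + (out v + 2)
        ≤⟨ +-monoʳ-≤ (7 * degree v) (+-monoʳ-≤ (out v) (*-monoʳ-≤ 2 (≤-trans
             (≤-reflexive (sym ([]-yes (w₀ Fin.≟ w₀) refl))) (term≤sum (λ w → [ w Fin.≟ w₀ ]) w₀)))) ⟩
      7 * degree v + (out v + 2 * ∑[ w < n ] [ w Fin.≟ w₀ ])
        ≡⟨ cong (7 * degree v +_) (trans (cong (out v +_) (*-distribˡ-sum 2 (λ w → [ w Fin.≟ w₀ ])))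
             (sym (∑-distrib-+ (λ w → [ T? (adj v w) ] * give (degree v) (degree w)) (λ w → 2 * [ w Fin.≟ w₀ ])))) ⟩
      7 * degree v + ∑[ w < n ] ([ T? (adj v w) ] * give (degree v) (degree w) + 2 * [ w Fin.≟ w₀ ])
        ≤⟨ +-monoʳ-≤ (7 * degree v) (sum-mono pointwise) ⟩
      7 * degree v + ∑[ w < n ] ([ T? (adj v w) ] * 7)
        ≡⟨ cong (7 * degree v +_) (∑-adj-const v 7) ⟩
      7 * degree v + degree v * 7
        ≡⟨ cong (λ d → 7 * d + d * 7) ≡3 ⟩
      42 ∎))
    where
    open ≤-Reasoning
    pointwise : ∀ w → [ T? (adj v w) ] * give (degree v) (degree w) + 2 * [ w Fin.≟ w₀ ] ≤ [ T? (adj v w) ] * 7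
    pointwise w with w Fin.≟ w₀
    ... | yes refl rewrite []-yes (T? (adj v w₀)) vw₀ = +-monoˡ-≤ 2 (≤-trans (≤-reflexive (+-identityʳ _))
            (≤-trans (give≤rate (degree v) (degree w₀) (¬high₀ ∘ proj₂)) (≤-reflexive (rate-low ≤3))))
    ... | no _ = ≤-trans (≤-reflexive (+-identityʳ _)) (*-monoʳ-≤ [ T? (adj v w) ] (give≤7 (degree v) (degree w) ≤3))

  fixed-balanced : ∀ v {d} → degree v ≡ d → 4 ≤ d → d ≤ 7 → 7 * d + d * rate d ≤ 40 → Balanced v
  fixed-balanced v refl 4≤ ≤7 ≤40 = balanced-poor (λ 8≤ → <-irrefl refl (≤-trans 8≤ ≤7))
    (≤-trans (+-monoʳ-≤ (7 * degree v) (out≤ v (rate (degree v)) λ w _ →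
               give≤rate (degree v) (degree w) λ (≤3 , _) → <-irrefl refl (≤-trans 4≤ ≤3)))
             ≤40)

  middle-balanced : ∀ v → 6 ≤ degree v → degree v ≤ 7 → Balanced v
  middle-balanced v 6≤ ≤7 = balanced-unhigh (λ 8≤ → <-irrefl refl (≤-trans 8≤ ≤7)) (begin
    7 * degree v + out v  ≤⟨ +-monoʳ-≤ (7 * degree v) (large-out 6≤) ⟩
    7 * degree v + 0      ≡⟨ +-identityʳ (7 * degree v) ⟩
    7 * degree v          ≤⟨ enough (m≤n⇒m<n∨m≡n ≤7) ⟩
    40 + inn v            ≤⟨ m≤m+n (40 + inn v) _ ⟩
    40 + inn v + 2 * [ surrounded? v ] ∎)
    where
    open ≤-Reasoning
    income : degree v * degree v + 6 ≤ inn v + 6 * degree v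
    income = middle-income v 6≤ ≤7
    -- `middle-income` yields 6 at degree 6 and 13 at degree 7, where 2 and 9 are needed.
    enough : degree v < 7 ⊎ degree v ≡ 7 → 7 * degree v ≤ 40 + inn v
    enough (inj₁ (s≤s ≤6)) = +-cancelʳ-≤ 36 _ _ (begin
      7 * degree v + 36  ≡⟨ cong (λ d → 7 * d + 36) d≡ ⟩
      42 + 36            ≤⟨ m≤m+n 78 4 ⟩
      40 + 42            ≡⟨ cong (λ d → 40 + (d * d + 6)) (sym d≡) ⟩
      40 + (degree v * degree v + 6) ≤⟨ +-monoʳ-≤ 40 income ⟩
      40 + (inn v + 6 * degree v)    ≡⟨ cong (λ d → 40 + (inn v + 6 * d)) d≡ ⟩
      40 + (inn v + 36)  ≡⟨ +-assoc 40 (inn v) 36 ⟨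
      40 + inn v + 36    ∎)
      where
      d≡ : degree v ≡ 6
      d≡ = ≤-antisym ≤6 6≤
    enough (inj₂ d≡) = +-cancelʳ-≤ 42 _ _ (begin
      7 * degree v + 42  ≡⟨ cong (λ d → 7 * d + 42) d≡ ⟩
      49 + 42            ≤⟨ m≤m+n 91 4 ⟩
      40 + 55            ≡⟨ cong (λ d → 40 + (d * d + 6)) (sym d≡) ⟩
      40 + (degree v * degree v + 6) ≤⟨ +-monoʳ-≤ 40 income ⟩
      40 + (inn v + 6 * degree v)    ≡⟨ cong (λ d → 40 + (inn v + 6 * d)) d≡ ⟩
      40 + (inn v + 42)  ≡⟨ +-assoc 40 (inn v) 42 ⟨
      40 + inn v + 42    ∎)

  -- The 7 received from every neighbour repays `7 * degree v` in full, so the initial 40 is left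
  -- over.
  high-balanced : ∀ v → High v → Balanced v
  high-balanced v 8≤ = begin
    7 * degree v + out v + 40 * [ high? v ]
      ≤⟨ +-mono-≤ (+-monoʳ-≤ (7 * degree v) (large-out (≤-trans (m≤n+m 6 2) 8≤))) (*-monoʳ-≤ 40 ([]≤1 (high? v))) ⟩
    7 * degree v + 0 + 40
      ≡⟨ collect (degree v) ⟩
    40 + degree v * 7
      ≡⟨ cong (40 +_) (∑-adj-const v 7) ⟨
    40 + ∑[ w < n ] ([ T? (adj v w) ] * 7)
      ≤⟨ +-monoʳ-≤ 40 (∑-adj-mono v λ w vw → ≤-reflexive (sym
           (give-high (degree w) (degree v) (high⇒low-neighbours (adj-sym vw) 8≤) 8≤))) ⟩
    40 + inn v
      ≤⟨ m≤m+n (40 + inn v) _ ⟩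
    40 + inn v + 2 * [ surrounded? v ] ∎
    where
    open ≤-Reasoning
    collect : ∀ d → 7 * d + 0 + 40 ≡ 40 + d * 7
    collect = solve-∀

  balanced : ∀ v → Balanced v
  balanced v with size (degree v)
  ... | low ≤3   = low-balanced v ≤3
  ... | four ≡4  = fixed-balanced v ≡4 ≤-refl (m≤n+m 4 3) ≤-refl
  ... | five ≡5  = fixed-balanced v ≡5 (n≤1+n 4) (m≤n+m 5 2) ≤-refl
  ... | large 6≤ with ≤-<-connex 8 (degree v)
  ...   | inj₁ 8≤ = high-balanced v 8≤
  ...   | inj₂ <8 = middle-balanced v 6≤ (≤-pred <8)

  -- The sum of `balanced` over all vertices, in which the payments cancel by `out-inn`. The total
  -- shortage is at most 4 per high vertex, against a reserve of 40.
  edgeCount-bound : 7 * edgeCount G ≤ 20 * n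
  edgeCount-bound = *-cancelˡ-≤ 2 (+-cancelʳ-≤ (∑[ v < n ] inn v + 40 * highs) _ _ (begin
    2 * (7 * edgeCount G) + (∑[ v < n ] inn v + 40 * highs)
      ≡⟨ regroup (edgeCount G) (∑[ v < n ] inn v) (40 * highs) ⟩
    7 * (2 * edgeCount G) + ∑[ v < n ] inn v + 40 * highs
      ≡⟨ cong₂ (λ d o → d + o + 40 * highs)
           (trans (cong (7 *_) (edgeCount≡ G)) (*-distribˡ-sum 7 degree)) (sym out-inn) ⟩
    ∑[ v < n ] (7 * degree v) + ∑[ v < n ] out v + 40 * highs
      ≡⟨ cong₂ _+_ (sym (∑-distrib-+ (λ v → 7 * degree v) out)) (*-distribˡ-sum 40 (λ v → [ high? v ])) ⟩
    ∑[ v < n ] (7 * degree v + out v) + ∑[ v < n ] (40 * [ high? v ])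
      ≡⟨ ∑-distrib-+ (λ v → 7 * degree v + out v) (λ v → 40 * [ high? v ]) ⟨
    ∑[ v < n ] (7 * degree v + out v + 40 * [ high? v ])
      ≤⟨ sum-mono balanced ⟩
    ∑[ v < n ] (40 + inn v + 2 * [ surrounded? v ])
      ≡⟨ ∑-distrib-+ (λ v → 40 + inn v) (λ v → 2 * [ surrounded? v ]) ⟩
    ∑[ v < n ] (40 + inn v) + ∑[ v < n ] (2 * [ surrounded? v ])
      ≡⟨ cong₂ _+_ (trans (∑-distrib-+ (λ _ → 40) inn) (cong (_+ ∑[ v < n ] inn v) (sum-const n 40)))
                   (sym (*-distribˡ-sum 2 (λ v → [ surrounded? v ]))) ⟩
    n * 40 + ∑[ v < n ] inn v + 2 * surroundeds
      ≤⟨ +-monoʳ-≤ (n * 40 + ∑[ v < n ] inn v) (≤-trans (*-monoʳ-≤ 2 HighSurrounded.surroundeds≤)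
           (≤-trans (≤-reflexive (sym (*-assoc 2 2 highs))) (*-monoˡ-≤ highs (m≤m+n 4 36)))) ⟩
    n * 40 + ∑[ v < n ] inn v + 40 * highs
      ≡⟨ ungroup n (∑[ v < n ] inn v) (40 * highs) ⟩
    2 * (20 * n) + (∑[ v < n ] inn v + 40 * highs) ∎))
    where
    open ≤-Reasoning
    regroup : ∀ e i h → 2 * (7 * e) + (i + h) ≡ 7 * (2 * e) + i + h
    regroup = solve-∀
    ungroup : ∀ n i h → n * 40 + i + h ≡ 2 * (20 * n) + (i + h)
    ungroup = solve-∀

theorem1p1 : ∀ (n : ℕ) → n ≥ 1 → ∀ (m : ℕ) → IsPlanarTuránNumber n (doubleStar 3 4) m →
    ℤ.+ m / 1 ℚᵘ.≤ (ℤ.+ 20 / 7) ℚᵘ.* (ℤ.+ n / 1)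
theorem1p1 n _ _ ((G , planar , free , refl) , _) = *≤* (begin
  -- The cross-multiplied form of the inequality of fractions.
  ℤ.+ edgeCount G ℤ.* ℤ.+ 7   ≡⟨ ℤ.pos-* (edgeCount G) 7 ⟨
  ℤ.+ (edgeCount G * 7)       ≡⟨ cong ℤ.+_ (*-comm (edgeCount G) 7) ⟩
  ℤ.+ (7 * edgeCount G)       ≤⟨ ℤ.+≤+ (Balance.edgeCount-bound planar free) ⟩
  ℤ.+ (20 * n)                ≡⟨ ℤ.pos-* 20 n ⟩
  ℤ.+ 20 ℤ.* ℤ.+ n            ≡⟨ ℤ.*-identityʳ (ℤ.+ 20 ℤ.* ℤ.+ n) ⟨
  ℤ.+ 20 ℤ.* ℤ.+ n ℤ.* ℤ.+ 1  ∎)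
  where open ℤ.≤-Reasoning
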